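{- After collecting identical normally ordered blocks, every coefficient of $\Delta_2(\alpha)$ and of $\Delta_3(\alpha)$ belongs to $\mathbb Z[\alpha]$. That is, when $\Delta_2(\alpha)$ and $\Delta_3(\alpha)$ are written as (locally finite) linear combinations of the distinct blocks $p_{I}D_{J}=p_{I_1}p_{I_2}\cdots D_{J_1}D_{J_2}\cdots$ indexed by pairs $(I,J)$ of finite multisets of positive integers, all coefficients lie in $\mathbb Z[\alpha]$.
   Context: $\Lambda=\mathbb Q(\alpha)[p_1,p_2,\dots]$, $D_k=k\,\partial/\partial p_k$. The operators of multiplication by the stable transposition and stable $3$-cycle class series for the Goulden--Jackson product are given explicitly by $$\Delta_2(\alpha)=\alpha\sum_{i,j\ge1}p_ip_jD_{i+j}+\sum_{i,j\ge1}p_{i+j}D_iD_j+(\alpha-1)\sum_{k\ge1}(k-1)p_kD_k,$$ $$\begin{aligned}\Delta_3(\alpha)={}&\sum_{i,j,k\ge1}\Bigl(p_{i+j+k}D_iD_jD_k+\alpha\,p_{i+k}p_jD_{i+j}D_k+\alpha\,p_{i+j}p_kD_iD_{j+k}\\&\qquad+p_{i+j+k}D_{i+j+k}+\alpha^2p_ip_jp_kD_{i+j+k}+\alpha\,p_ip_{j+k}D_{i+k}D_j\Bigr)\\&+(\alpha-1)\Biggl[\frac32\sum_{i,j\ge1}(i+j-2)\bigl(\alpha\,p_ip_jD_{i+j}+p_{i+j}D_iD_j\bigr)+(2\alpha-1)\sum_{k\ge1}\binom{k-1}{2}p_kD_k\Biggr].\end{aligned}$$ -}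

module Defs where

open import Algebra.Bundles.Raw using (RawRing)
import Algebra.Definitions.RawSemiring as RawSemiringDefinitions
open import Data.Bool.Base using (if_then_else_)
open import Data.Integer.Base using (ℤ; +_)
open import Data.List.Base using (List; []; _∷_; _++_; map; concat; concatMap; foldr; upTo)
open import Data.List.Extrema.Nat using (max; xs≤max)
open import Data.List.Properties using (concatMap-++)
open import Data.Sum.Base as Sum using (_⊎_; inj₁; inj₂; [_,_]′)
open import Data.List.Membership.Propositional using (_∈_; _∉_)
open import Data.List.Membership.Propositional.Properties using (∈-∃++; ∈-map⁺; ∈-++⁻; ∈-++⁺ˡ; ∈-++⁺ʳ)
import Data.List.Membership.Setoid as SetoidMembership
open import Data.List.Relation.Binary.Permutation.Propositional
  using (_↭_; ↭-refl; ↭-sym; ↭-trans; prep; ↭-setoid)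
open import Data.List.Relation.Binary.Permutation.Propositional.Properties
  using (shift; drop-∷; ∈-resp-↭; ¬x∷xs↭[])
open import Data.List.Relation.Unary.All using (lookup)
open import Data.List.Relation.Unary.Any using (Any; here; there; any?)
import Data.List.Relation.Unary.Unique.Setoid as SetoidUnique
open import Data.Nat.Base as ℕ using (ℕ; zero; suc; _∸_; _<_)
open import Data.Nat.Combinatorics using (_C_)
import Data.Nat.Properties as ℕ
open import Data.Product.Base using (∃; _×_; _,_; proj₁; proj₂; map₁; map₂)
open import Data.Product.Relation.Binary.Pointwise.NonDependent using (×-setoid)
open import Data.Rational.Base as ℚ using (ℚ; 0ℚ; 1ℚ; ≢-nonZero)
import Data.Rational.Properties as ℚ
open import Function.Base using (_∘_)
open import Function.Definitions using (Congruent)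
open import Level using (0ℓ)
open import Relation.Binary.Bundles using (Setoid)
open import Relation.Binary.Definitions using (DecidableEquality)
open import Relation.Binary.PropositionalEquality
  using (_≡_; _≢_; refl; sym; trans; cong; cong₂; subst; module ≡-Reasoning)
open import Relation.Nullary.Decidable using (Dec; yes; no; does; map′)
open import Relation.Nullary.Negation using (contradiction)

------------------------------------------------------------------------
-- ℚ[α] and ℚ(α)

-- [a₀, a₁, …] denotes a₀ + a₁ α + …; trailing zeros are allowed.
Poly : Set
Poly = List ℚ

coeffₚ : Poly → ℕ → ℚ
coeffₚ []      _       = 0ℚ
coeffₚ (x ∷ _) zero    = x
coeffₚ (_ ∷ a) (suc n) = coeffₚ a n

infix 4 _≈ₚ_
_≈ₚ_ : Poly → Poly → Set
a ≈ₚ b = ∀ n → coeffₚ a n ≡ coeffₚ b n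

Nonzeroₚ : Poly → Set
Nonzeroₚ = Any (_≢ 0ℚ)

infixl 6 _+ₚ_
infixl 7 _*ₚ_

_+ₚ_ : Poly → Poly → Poly
[]      +ₚ b       = b
(x ∷ a) +ₚ []      = x ∷ a
(x ∷ a) +ₚ (y ∷ b) = (x ℚ.+ y) ∷ (a +ₚ b)

-ₚ_ : Poly → Poly
-ₚ_ = map λ x → ℚ.- x

_*ₚ_ : Poly → Poly → Poly
[]      *ₚ b = []
(x ∷ a) *ₚ b = map (x ℚ.*_) b +ₚ (0ℚ ∷ a *ₚ b)

-- ℚ[α] has no zero divisors, so fractions can be added and multiplied.
private
  coeff-+ : ∀ a b n → coeffₚ (a +ₚ b) n ≡ coeffₚ a n ℚ.+ coeffₚ b n
  coeff-+ []      b       n       = sym (ℚ.+-identityˡ _)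
  coeff-+ (x ∷ a) []      n       = sym (ℚ.+-identityʳ _)
  coeff-+ (x ∷ a) (y ∷ b) zero    = refl
  coeff-+ (x ∷ a) (y ∷ b) (suc n) = coeff-+ a b n

  coeff-scale : ∀ x b n → coeffₚ (map (x ℚ.*_) b) n ≡ x ℚ.* coeffₚ b n
  coeff-scale x []      n       = sym (ℚ.*-zeroʳ x)
  coeff-scale x (y ∷ b) zero    = refl
  coeff-scale x (y ∷ b) (suc n) = coeff-scale x b n

  coeff-* : ∀ x a b n →
            coeffₚ ((x ∷ a) *ₚ b) n ≡ x ℚ.* coeffₚ b n ℚ.+ coeffₚ (0ℚ ∷ a *ₚ b) n
  coeff-* x a b n = trans (coeff-+ (map (x ℚ.*_) b) _ n)
                          (cong (ℚ._+ coeffₚ (0ℚ ∷ a *ₚ b) n) (coeff-scale x b n))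

  shift-* : ∀ a b → a *ₚ (0ℚ ∷ b) ≈ₚ 0ℚ ∷ (a *ₚ b)
  shift-* []      b zero    = refl
  shift-* []      b (suc n) = refl
  shift-* (x ∷ a) b zero    = trans (coeff-* x a (0ℚ ∷ b) zero)
                                    (trans (ℚ.+-identityʳ _) (ℚ.*-zeroʳ x))
  shift-* (x ∷ a) b (suc n) =
    trans (coeff-* x a (0ℚ ∷ b) (suc n))
          (trans (cong (x ℚ.* coeffₚ b n ℚ.+_) (shift-* a b n))
                 (sym (coeff-* x a b n)))

  witness : ∀ {a} → Nonzeroₚ a → ∃ λ n → coeffₚ a n ≢ 0ℚ
  witness (here x≢0) = zero , x≢0
  witness (there a≢0) with witness a≢0
  ... | n , q = suc n , q

  nonzero : ∀ a n → coeffₚ a n ≢ 0ℚ → Nonzeroₚ a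
  nonzero []      n       q = contradiction refl q
  nonzero (x ∷ a) zero    q = here q
  nonzero (x ∷ a) (suc n) q = there (nonzero a n q)

  *-≢0 : ∀ {x y} → x ≢ 0ℚ → y ≢ 0ℚ → x ℚ.* y ≢ 0ℚ
  *-≢0 {x} {y} x≢0 y≢0 xy≡0 = y≢0 (begin
    y                     ≡⟨ ℚ.*-identityˡ y ⟨
    1ℚ ℚ.* y              ≡⟨ cong (ℚ._* y) (ℚ.*-inverseˡ x) ⟨
    ℚ.1/ x ℚ.* x ℚ.* y    ≡⟨ ℚ.*-assoc (ℚ.1/ x) x y ⟩
    ℚ.1/ x ℚ.* (x ℚ.* y)  ≡⟨ cong (ℚ.1/ x ℚ.*_) xy≡0 ⟩
    ℚ.1/ x ℚ.* 0ℚ         ≡⟨ ℚ.*-zeroʳ (ℚ.1/ x) ⟩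
    0ℚ                    ∎)
    where
    open ≡-Reasoning
    instance _ = ≢-nonZero x≢0

*ₚ-nonzero : ∀ {a b} → Nonzeroₚ a → Nonzeroₚ b → Nonzeroₚ (a *ₚ b)
*ₚ-nonzero {x ∷ a} {b} a≢0 b≢0 with x ℚ.≟ 0ℚ
*ₚ-nonzero {x ∷ a} {b} (here x≢0) b≢0 | yes x≡0 = contradiction x≡0 x≢0
*ₚ-nonzero {x ∷ a} {b} (there a≢0) b≢0 | yes refl
  with witness (*ₚ-nonzero a≢0 b≢0)
... | n , q = nonzero _ (suc n) (subst (_≢ 0ℚ) (sym eq) q)
  where
  eq : coeffₚ ((0ℚ ∷ a) *ₚ b) (suc n) ≡ coeffₚ (a *ₚ b) n
  eq = trans (coeff-* 0ℚ a b (suc n))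
             (trans (cong (ℚ._+ coeffₚ (a *ₚ b) n) (ℚ.*-zeroˡ (coeffₚ b (suc n))))
                    (ℚ.+-identityˡ _))
*ₚ-nonzero {x ∷ a} {y ∷ b} a≢0 b≢0 | no x≢0 with y ℚ.≟ 0ℚ
... | no y≢0 = here (subst (_≢ 0ℚ) (sym (ℚ.+-identityʳ _)) (*-≢0 x≢0 y≢0))
*ₚ-nonzero {x ∷ a} {y ∷ b} a≢0 (here y≢0) | no x≢0 | yes y≡0 = contradiction y≡0 y≢0
*ₚ-nonzero {x ∷ a} {y ∷ b} a≢0 (there b≢0) | no x≢0 | yes refl
  with witness (*ₚ-nonzero {x ∷ a} {b} (here x≢0) b≢0)
... | n , q = nonzero _ (suc n) (subst (_≢ 0ℚ) (sym (shift-* (x ∷ a) b (suc n))) q)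

record ℚ⟨α⟩ : Set where
  constructor _/_[_]
  field
    num   : Poly
    den   : Poly
    den≢0 : Nonzeroₚ den

const : ℚ → ℚ⟨α⟩
const q = (q ∷ []) / (1ℚ ∷ []) [ here (λ ()) ]

infix  4 _≈ᶠ_
infixl 6 _+ᶠ_
infixl 7 _*ᶠ_

_≈ᶠ_ : ℚ⟨α⟩ → ℚ⟨α⟩ → Set
(a / b [ _ ]) ≈ᶠ (c / d [ _ ]) = a *ₚ d ≈ₚ c *ₚ b

_+ᶠ_ : ℚ⟨α⟩ → ℚ⟨α⟩ → ℚ⟨α⟩
(a / b [ b≢0 ]) +ᶠ (c / d [ d≢0 ]) =
  (a *ₚ d +ₚ c *ₚ b) / (b *ₚ d) [ *ₚ-nonzero b≢0 d≢0 ]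

_*ᶠ_ : ℚ⟨α⟩ → ℚ⟨α⟩ → ℚ⟨α⟩
(a / b [ b≢0 ]) *ᶠ (c / d [ d≢0 ]) = (a *ₚ c) / (b *ₚ d) [ *ₚ-nonzero b≢0 d≢0 ]

-ᶠ_ : ℚ⟨α⟩ → ℚ⟨α⟩
-ᶠ (a / b [ b≢0 ]) = (-ₚ a) / b [ b≢0 ]

ℚ⟨α⟩-rawRing : RawRing 0ℓ 0ℓ
ℚ⟨α⟩-rawRing = record
  { Carrier = ℚ⟨α⟩
  ; _≈_     = _≈ᶠ_
  ; _+_     = _+ᶠ_
  ; _*_     = _*ᶠ_
  ; -_      = -ᶠ_
  ; 0#      = const 0ℚ
  ; 1#      = const 1ℚ
  }

α : ℚ⟨α⟩
α = (0ℚ ∷ 1ℚ ∷ []) / (1ℚ ∷ []) [ here (λ ()) ]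

ℤ[α]→ℚ⟨α⟩ : List ℤ → ℚ⟨α⟩
ℤ[α]→ℚ⟨α⟩ q = map (ℚ._/ 1) q / (1ℚ ∷ []) [ here (λ ()) ]

_∈ℤ[α] : ℚ⟨α⟩ → Set
x ∈ℤ[α] = ∃ λ q → x ≈ᶠ ℤ[α]→ℚ⟨α⟩ q

------------------------------------------------------------------------
-- Finite multisets of positive integers: lists up to permutation

record ℕ⁺ : Set where
  constructor 1+_
  field
    pred : ℕ

toℕ : ℕ⁺ → ℕ
toℕ (1+ n) = suc n

infixl 6 _+⁺_
_+⁺_ : ℕ⁺ → ℕ⁺ → ℕ⁺
(1+ m) +⁺ (1+ n) = 1+ (m ℕ.+ suc n)

_≟⁺_ : DecidableEquality ℕ⁺
(1+ m) ≟⁺ (1+ n) = map′ (cong 1+_) (cong ℕ⁺.pred) (m ℕ.≟ n)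

[1…_] : ℕ → List ℕ⁺
[1… n ] = map 1+_ (upTo n)

Multiset : Set
Multiset = List ℕ⁺

infix 4 _↭?_
_↭?_ : (I J : Multiset) → Dec (I ↭ J)
[]      ↭? []      = yes ↭-refl
[]      ↭? (_ ∷ _) = no (¬x∷xs↭[] ∘ ↭-sym)
(i ∷ I) ↭? J with any? (i ≟⁺_) J
... | no i∉J = no λ I↭J → i∉J (∈-resp-↭ I↭J (here refl))
... | yes i∈J with ∈-∃++ i∈J
...   | J₁ , J₂ , refl = map′
        (λ I↭J → ↭-trans (prep i I↭J) (↭-sym (shift i J₁ J₂)))
        (λ I↭J → drop-∷ (↭-trans I↭J (shift i J₁ J₂)))
        (I ↭? J₁ ++ J₂)

-- (I , J) indexes the normally ordered block p_I D_J.
Block : Set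
Block = Multiset × Multiset

Block-setoid : Setoid 0ℓ 0ℓ
Block-setoid = ×-setoid (↭-setoid {A = ℕ⁺}) (↭-setoid {A = ℕ⁺})

open Setoid Block-setoid public using () renaming (_≈_ to _≈ᴮ_)
open SetoidUnique Block-setoid public using (Unique)
open SetoidMembership Block-setoid public using () renaming (_∉_ to _∉ᴮ_)

------------------------------------------------------------------------
-- The polynomial ring K[p₁, p₂, …] and operators on it

module Operators (K : RawRing 0ℓ 0ℓ) where
  open RawRing K
  private module K = RawSemiringDefinitions rawSemiring

  ι : ℕ → Carrier
  ι n = n K.× 1#

  -- A finite formal sum of terms a p_I. Terms with the same monomial may be
  -- repeated, so equality compares coefficients.
  Λ : Set
  Λ = List (Carrier × Multiset)

  coeff : Λ → Multiset → Carrier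
  coeff []            I = 0#
  coeff ((a , J) ∷ f) I = if does (J ↭? I) then a + coeff f I else coeff f I

  infix 4 _≈ᴸ_
  _≈ᴸ_ : Λ → Λ → Set
  f ≈ᴸ g = ∀ I → coeff f I ≈ coeff g I

  Op : Set
  Op = Λ → Λ

  infixl 6 _⊕_
  infixr 8 _·_

  _⊕_ : Op → Op → Op
  (S ⊕ T) f = S f ++ T f

  _·_ : Carrier → Op → Op
  (a · T) f = map (map₁ (a *_)) (T f)

  p : ℕ⁺ → Op
  p k = map (map₂ (k ∷_))

  -- The Leibniz rule for ∂p_I/∂p_k: one summand p_{I∖k} for each occurrence
  -- of k in I.
  ∂-monomial : ℕ⁺ → Multiset → List Multiset
  ∂-monomial k []      = []
  ∂-monomial k (i ∷ I) with k ≟⁺ i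
  ... | yes _ = I ∷ map (i ∷_) (∂-monomial k I)
  ... | no  _ = map (i ∷_) (∂-monomial k I)

  ∂ : ℕ⁺ → Op
  ∂ k = concatMap λ (a , I) → map (a ,_) (∂-monomial k I)

  D : ℕ⁺ → Op
  D k = ι (toℕ k) · ∂ k

  indices : Λ → List ℕ⁺
  indices = concatMap proj₂

  bound : Λ → ℕ
  bound f = max 0 (map toℕ (indices f))

  -- The infinite sum ∑_{i≥1} T i, for families with T i f = 0 whenever
  -- i > bound f. This covers iterated sums of operators in normal order in
  -- which every summation index occurs in the subscript of some D:
  -- D k f = 0 for k > bound f, and applying D introduces no new indices
  -- (D-vanishes and indices-D below).
  ∑⁺ : (ℕ⁺ → Op) → Op
  ∑⁺ T f = concatMap (λ i → T i f) [1… bound f ]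

  p* : Multiset → Op
  p* I f = foldr p f I

  D* : Multiset → Op
  D* J f = foldr D f J

  -- ∑_b T b = g, where all but finitely many of the T b vanish.
  record HasSum (T : Block → Λ) (g : Λ) : Set where
    field
      support : List Block
      unique  : Unique support
      outside : ∀ b → b ∉ᴮ support → T b ≈ᴸ []
      total   : concatMap T support ≈ᴸ g

  -- Δ = ∑_{(I,J)} c(I,J) p_I D_J, locally finitely.
  record IsExpansion (Δ : Op) (c : Block → Carrier) : Set where
    field
      respects : Congruent _≈ᴮ_ _≈_ c
      sums     : ∀ f → HasSum (λ (I , J) → (c (I , J) · p* I ∘ D* J) f) (Δ f)

  ----------------------------------------------------------------------
  -- Justification of the truncation in ∑⁺

  private
    ∂-monomial-∉ : ∀ k I → k ∉ I → ∂-monomial k I ≡ []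
    ∂-monomial-∉ k []      _ = refl
    ∂-monomial-∉ k (i ∷ I) k∉ with k ≟⁺ i
    ... | yes refl = contradiction (here refl) k∉
    ... | no _     = cong (map (i ∷_)) (∂-monomial-∉ k I (k∉ ∘ there))

    ∂-∉ : ∀ k f → k ∉ indices f → ∂ k f ≡ []
    ∂-∉ k []            _  = refl
    ∂-∉ k ((a , I) ∷ f) k∉ =
      cong₂ _++_ (cong (map (a ,_)) (∂-monomial-∉ k I (k∉ ∘ ∈-++⁺ˡ)))
                 (∂-∉ k f (k∉ ∘ ∈-++⁺ʳ I))

  D-vanishes : ∀ k f → bound f < toℕ k → D k f ≡ []
  D-vanishes k f b<k = cong (map (map₁ (ι (toℕ k) *_))) (∂-∉ k f λ k∈ →
    ℕ.<⇒≱ b<k (lookup (xs≤max 0 (map toℕ (indices f))) (∈-map⁺ toℕ k∈)))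

  private
    indices-scale : ∀ x f → indices (map (map₁ (x *_)) f) ≡ indices f
    indices-scale x []            = refl
    indices-scale x ((a , I) ∷ f) = cong (I ++_) (indices-scale x f)

    indices-monomials : ∀ a Is → indices (map (a ,_) Is) ≡ concat Is
    indices-monomials a []       = refl
    indices-monomials a (I ∷ Is) = cong (I ++_) (indices-monomials a Is)

    ∈-map-∷ : ∀ (j : ℕ⁺) Is {i} → i ∈ concat (map (j ∷_) Is) → i ≡ j ⊎ i ∈ concat Is
    ∈-map-∷ j (I ∷ Is) (here i≡j) = inj₁ i≡j
    ∈-map-∷ j (I ∷ Is) (there i∈) with ∈-++⁻ I i∈
    ... | inj₁ i∈I = inj₂ (∈-++⁺ˡ i∈I)
    ... | inj₂ i∈′ = Sum.map₂ (∈-++⁺ʳ I) (∈-map-∷ j Is i∈′)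

    ∈-∂-monomial : ∀ k I {i} → i ∈ concat (∂-monomial k I) → i ∈ I
    ∈-∂-monomial k (j ∷ I) i∈ with k ≟⁺ j
    ... | no _ = [ here , there ∘ ∈-∂-monomial k I ]′ (∈-map-∷ j (∂-monomial k I) i∈)
    ... | yes _ with ∈-++⁻ I i∈
    ...   | inj₁ i∈I = there i∈I
    ...   | inj₂ i∈′ = [ here , there ∘ ∈-∂-monomial k I ]′ (∈-map-∷ j (∂-monomial k I) i∈′)

    indices-∂ : ∀ k f {i} → i ∈ indices (∂ k f) → i ∈ indices f
    indices-∂ k ((a , I) ∷ f) i∈
      with ∈-++⁻ (indices (map (a ,_) (∂-monomial k I)))
             (subst (_ ∈_) (concatMap-++ proj₂ (map (a ,_) (∂-monomial k I)) _) i∈)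
    ... | inj₁ i∈I = ∈-++⁺ˡ (∈-∂-monomial k I
                       (subst (_ ∈_) (indices-monomials a (∂-monomial k I)) i∈I))
    ... | inj₂ i∈f = ∈-++⁺ʳ I (indices-∂ k f i∈f)

  indices-D : ∀ k f {i} → i ∈ indices (D k f) → i ∈ indices f
  indices-D k f i∈ =
    indices-∂ k f (subst (_ ∈_) (indices-scale (ι (toℕ k)) (∂ k f)) i∈)

------------------------------------------------------------------------
-- Δ₂(α) and Δ₃(α)

open Operators ℚ⟨α⟩-rawRing public
open RawRing ℚ⟨α⟩-rawRing using (_+_; _*_; -_; 1#)

Δ₂ : Op
Δ₂ = α · (∑⁺ λ i → ∑⁺ λ j → p i ∘ p j ∘ D (i +⁺ j))
   ⊕ (∑⁺ λ i → ∑⁺ λ j → p (i +⁺ j) ∘ D i ∘ D j)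
   ⊕ (α + - 1#) · (∑⁺ λ k → ι (toℕ k ∸ 1) · p k ∘ D k)

Δ₃ : Op
Δ₃ = (∑⁺ λ i → ∑⁺ λ j → ∑⁺ λ k →
          p (i +⁺ j +⁺ k) ∘ D i ∘ D j ∘ D k
        ⊕ α · p (i +⁺ k) ∘ p j ∘ D (i +⁺ j) ∘ D k
        ⊕ α · p (i +⁺ j) ∘ p k ∘ D i ∘ D (j +⁺ k)
        ⊕ p (i +⁺ j +⁺ k) ∘ D (i +⁺ j +⁺ k)
        ⊕ (α * α) · p i ∘ p j ∘ p k ∘ D (i +⁺ j +⁺ k)
        ⊕ α · p i ∘ p (j +⁺ k) ∘ D (i +⁺ k) ∘ D j)
   ⊕ (α + - 1#) ·
       ( const (+ 3 ℚ./ 2) · (∑⁺ λ i → ∑⁺ λ j → ι (toℕ i ℕ.+ toℕ j ∸ 2) ·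
             ( α · p i ∘ p j ∘ D (i +⁺ j)
             ⊕ p (i +⁺ j) ∘ D i ∘ D j))
       ⊕ (ι 2 * α + - 1#) · (∑⁺ λ k → ι ((toℕ k ∸ 1) C 2) · p k ∘ D k))

-- An operator ∑ a_t p_{I_t} D_{J_t} whose summation indices all occur in the subscripts of the
-- D's acts on f as a finite sum, and collecting equal blocks gives one expansion. Expansions are
-- unique over any ring containing ℚ: D_{J′} p_J has a p_K-term only if J = J′ ⊎ K, so comparing
-- the coefficients of p_I in the image of p_J determines the coefficient of p_I D_J by induction
-- on the length of J. It remains to see that the collected coefficients are integral. The only
-- denominators come from the factor 3/2; there the terms (i , j) and (j , i) have the same blocks,
-- which doubles them off the diagonal, and on the diagonal i + i − 2 is even.

module Submission where

open import Algebra.Bundles using (CommutativeRing)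
import Algebra.Consequences.Setoid as Consequences
import Algebra.Properties.Ring
import Algebra.Properties.Semiring.Mult
import Algebra.Solver.Ring.NaturalCoefficients.Default as Solver
open import Data.Bool.Base using (true; false; if_then_else_)
open import Data.Integer.Base as ℤ using (+_)
import Data.Integer.Properties as ℤ
open import Data.List.Base using (List; []; _∷_; _++_; map; concatMap; upTo; length; filter; deduplicate)
open import Data.List.Extrema.Nat using (max; xs≤max; max≤v⁺)
open import Data.List.Membership.Propositional using (_∉_)
open import Data.List.Membership.Propositional.Properties using (∈-∃++)
import Data.List.Properties as List
open import Data.List.Relation.Binary.Permutation.Propositional using (_↭_; ↭-refl; ↭-sym; ↭-trans; ↭-reflexive)
import Data.List.Relation.Binary.Permutation.Propositional as ↭
import Data.List.Relation.Binary.Permutation.Propositional.Properties as ↭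
open import Data.List.Relation.Unary.All as All using (All; []; _∷_)
import Data.List.Relation.Unary.All.Properties as All
open import Data.List.Relation.Unary.AllPairs using ([]; _∷_)
open import Data.List.Relation.Unary.Any as Any using (Any; here; there; any?)
import Data.List.Relation.Unary.Any.Properties as Any
open import Data.List.Relation.Unary.Unique.DecSetoid.Properties using (deduplicate-!)
open import Data.Nat.Base as ℕ using (ℕ; zero; suc; _≤_; _<_; _∸_)
open import Data.Nat.Combinatorics using (_C_)
import Data.Nat.Properties as ℕ
open import Data.Product.Base using (∃; _×_; _,_; proj₁; proj₂; map₁)
open import Data.Product.Relation.Binary.Pointwise.NonDependent using (×-decidable)
open import Data.Rational.Base as ℚ using (ℚ; 0ℚ; 1ℚ)
import Data.Rational.Properties as ℚ
import Data.Rational.Unnormalised.Base as ℚᵘ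
import Data.Rational.Unnormalised.Properties as ℚᵘ
open import Data.Sum.Base using (_⊎_; inj₁; inj₂)
open import Data.Unit.Base using (⊤; tt)
open import Function.Base using (_∘_; id)
open import Level using (0ℓ)
open import Relation.Binary.Bundles using (Setoid; DecSetoid)
open import Relation.Binary.Definitions using (Decidable)
open import Relation.Binary.PropositionalEquality as ≡ using (_≡_; _≢_; cong; cong₂)
open import Relation.Binary.Structures using (IsEquivalence)
import Relation.Binary.Reasoning.Setoid as SetoidReasoning
open import Relation.Nullary.Decidable using (Dec; yes; no; does; ¬?)
open import Relation.Nullary.Negation using (contradiction; ¬_)
-- Defs is opened only after the module OperatorProperties, which works with the operators over an
-- arbitrary ring.
import Defs
open Defs using
  ( Poly; coeffₚ; _≈ₚ_; Nonzeroₚ; _+ₚ_; -ₚ_; _*ₚ_; *ₚ-nonzero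
  ; ℚ⟨α⟩; _/_[_]; _≈ᶠ_; _+ᶠ_; _*ᶠ_; -ᶠ_; const
  ; ℕ⁺; 1+_; toℕ; _+⁺_; _≟⁺_; [1…_]; Multiset; _↭?_
  ; Block; Block-setoid; _≈ᴮ_; Unique; _∉ᴮ_ )

-- The obstacle is that `∑⁺` truncates at `bound f`, so coefficients collected while evaluating at
-- `f` depend on `f`, whereas an expansion needs one coefficient function for all `f`. The operators
-- are therefore written as terms of a small syntax, from which both the action and the coefficients
-- truncated at a given n are computed. Every summation index is bounded by the subscript of some D
-- in each block below it, so the coefficient of p_I D_J stops changing once n reaches the largest
-- entry of J; this stable value is the coefficient of the expansion. If `bound f` is smaller than
-- that entry, the truncated and the stable value may differ, but then D_J f = 0 and only their
-- products with the action are compared. Existence of expansions and the integrality argument work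
-- over any commutative ring with a chosen subring. Inverses of positive integers enter in
-- uniqueness alone, through the number D_J p_J.

infix 4 _≟ᴮ_
_≟ᴮ_ : Decidable _≈ᴮ_
_≟ᴮ_ = ×-decidable _↭?_ _↭?_

Block-decSetoid : DecSetoid 0ℓ 0ℓ
Block-decSetoid = record
  { isDecEquivalence = record
    { isEquivalence = Setoid.isEquivalence Block-setoid
    ; _≟_           = _≟ᴮ_
    }
  }

private module ≈ᴮ = Setoid Block-setoid

-- Finite multisets: cancellation, subtraction, multiplicity and maximum

[1…]-suc : ∀ n → [1… suc n ] ≡ [1… n ] ++ 1+ n ∷ []
[1…]-suc n = ≡.trans (cong (map 1+_) (≡.sym (List.upTo-∷ʳ n))) (List.map-++ 1+_ (upTo n) (n ∷ []))

++-cancelˡ : ∀ (I : Multiset) {J K} → I ++ J ↭ I ++ K → J ↭ K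
++-cancelˡ []      J↭K = J↭K
++-cancelˡ (i ∷ I) J↭K = ++-cancelˡ I (↭.drop-∷ J↭K)

↭-++⇒[] : ∀ {J : Multiset} J′ {K} → length J ≤ length J′ → J ↭ J′ ++ K → K ≡ []
↭-++⇒[]     J′ {[]}    ∣J∣≤∣J′∣ J↭J′K  = ≡.refl
↭-++⇒[] {J} J′ {k ∷ K} ∣J∣≤∣J′∣ J↭J′kK = contradiction ∣J∣≤∣J′∣ (ℕ.<⇒≱ (begin-strict
  length J′                     ≤⟨ ℕ.m≤m+n (length J′) (length K) ⟩
  length J′ ℕ.+ length K        <⟨ ℕ.≤-reflexive (≡.sym (ℕ.+-suc (length J′) (length K))) ⟩
  length J′ ℕ.+ length (k ∷ K)  ≡⟨ List.length-++ J′ ⟨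
  length (J′ ++ k ∷ K)          ≡⟨ ↭.↭-length J↭J′kK ⟨
  length J                      ∎))
  where open ℕ.≤-Reasoning

remove : ∀ (k : ℕ⁺) I → (∃ λ K → k ∷ K ↭ I) ⊎ k ∉ I
remove k I with any? (k ≟⁺_) I
... | no k∉I = inj₂ k∉I
... | yes k∈I with ∈-∃++ k∈I
...   | I₁ , I₂ , ≡.refl = inj₁ (I₁ ++ I₂ , ↭-sym (↭.shift k I₁ I₂))

-- Decides whether p_I divides p_M. By cancellation it does not matter which occurrence of `i` is
-- removed from `M`, so a greedy search is conclusive in both directions.
difference : ∀ (I M : Multiset) → Dec (∃ λ K → I ++ K ↭ M)
difference []      M = yes (M , ↭-refl)
difference (i ∷ I) M with remove i M
... | inj₂ i∉M = no λ (K , I+K↭M) → i∉M (↭.∈-resp-↭ I+K↭M (here ≡.refl))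
... | inj₁ (M′ , i∷M′↭M) with difference I M′
...   | yes (K , I+K↭M′) = yes (K , ↭-trans (↭.prep i I+K↭M′) i∷M′↭M)
...   | no ∄K = no λ (K , I+K↭M) → ∄K (K , ↭.drop-∷ (↭-trans I+K↭M (↭-sym i∷M′↭M)))

mult : ℕ⁺ → Multiset → ℕ
mult k I = length (filter (k ≟⁺_) I)

mult-↭ : ∀ k {I J} → I ↭ J → mult k I ≡ mult k J
mult-↭ k I↭J = ↭.↭-length (↭.filter-↭ (k ≟⁺_) I↭J)

mult-≡ : ∀ k I → mult k (k ∷ I) ≡ suc (mult k I)
mult-≡ k I = cong length (List.filter-accept (k ≟⁺_) ≡.refl)

mult-≢ : ∀ {k j} I → k ≢ j → mult k (j ∷ I) ≡ mult k I
mult-≢ {k} I k≢j = cong length (List.filter-reject (k ≟⁺_) k≢j)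

mult-∉ : ∀ {k} I → k ∉ I → mult k I ≡ 0
mult-∉ {k} I k∉I = cong length (List.filter-none (k ≟⁺_) (All.¬Any⇒All¬ I k∉I))

maximum : Multiset → ℕ
maximum J = max 0 (map toℕ J)

≤-maximum : ∀ J → All (λ j → toℕ j ≤ maximum J) J
≤-maximum J = All.map⁻ (xs≤max 0 (map toℕ J))

maximum-≤ : ∀ {J n} → All (λ j → toℕ j ≤ n) J → maximum J ≤ n
maximum-≤ J≤n = max≤v⁺ ℕ.z≤n (All.map⁺ J≤n)

maximum-↭ : ∀ {I J} → I ↭ J → maximum I ≡ maximum J
maximum-↭ {I} {J} I↭J = ℕ.≤-antisym
  (maximum-≤ (↭.All-resp-↭ (↭-sym I↭J) (≤-maximum J)))
  (maximum-≤ (↭.All-resp-↭ I↭J (≤-maximum I)))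

module OperatorProperties (R : CommutativeRing 0ℓ 0ℓ) where
  open CommutativeRing R renaming (refl to ≈-refl; sym to ≈-sym; trans to ≈-trans)
  open Algebra.Properties.Ring ring
    using (-‿+-comm; -0#≈0#) renaming (x∙y⁻¹≈ε⇒x≈y to x-y≈0⇒x≈y; x≈y⇒x∙y⁻¹≈ε to x≈y⇒x-y≈0)
  open Algebra.Properties.Semiring.Mult semiring using (×1-homo-*; ×-homo-+)
  open Defs.Operators rawRing
  open SetoidReasoning setoid
  open Solver commutativeSemiring using (solve; _:+_; _:*_; _:=_)

  private variable
    A B P Q : Set

  -- Finite sums in the coefficient ring

  sum : (A → Carrier) → List A → Carrier
  sum g []       = 0#
  sum g (x ∷ xs) = g x + sum g xs

  sum-cong-All : ∀ {g h : A → Carrier} {xs} → All (λ x → g x ≈ h x) xs → sum g xs ≈ sum h xs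
  sum-cong-All []             = ≈-refl
  sum-cong-All (gx≈hx ∷ g≈h) = +-cong gx≈hx (sum-cong-All g≈h)

  sum-cong : ∀ {g h : A → Carrier} → (∀ x → g x ≈ h x) → ∀ xs → sum g xs ≈ sum h xs
  sum-cong g≈h xs = sum-cong-All (All.universal g≈h xs)

  sum-zero : ∀ {g : A → Carrier} {xs} → All (λ x → g x ≈ 0#) xs → sum g xs ≈ 0#
  sum-zero []             = ≈-refl
  sum-zero (gx≈0 ∷ g≈0) = ≈-trans (+-cong gx≈0 (sum-zero g≈0)) (+-identityˡ 0#)

  sum-++ : ∀ (g : A → Carrier) xs ys → sum g (xs ++ ys) ≈ sum g xs + sum g ys
  sum-++ g []       ys = ≈-sym (+-identityˡ _)
  sum-++ g (x ∷ xs) ys = ≈-trans (+-congˡ (sum-++ g xs ys)) (≈-sym (+-assoc _ _ _))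

  sum-+ : ∀ (g h : A → Carrier) xs → sum (λ x → g x + h x) xs ≈ sum g xs + sum h xs
  sum-+ g h []       = ≈-sym (+-identityˡ 0#)
  sum-+ g h (x ∷ xs) = ≈-trans (+-congˡ (sum-+ g h xs))
    (solve 4 (λ a b c d → (a :+ b) :+ (c :+ d) := (a :+ c) :+ (b :+ d)) ≈-refl
      (g x) (h x) (sum g xs) (sum h xs))

  sum-*ˡ : ∀ a (g : A → Carrier) xs → sum (λ x → a * g x) xs ≈ a * sum g xs
  sum-*ˡ a g []       = ≈-sym (zeroʳ a)
  sum-*ˡ a g (x ∷ xs) = ≈-trans (+-congˡ (sum-*ˡ a g xs)) (≈-sym (distribˡ a _ _))

  sum-*ʳ : ∀ (g : A → Carrier) a xs → sum (λ x → g x * a) xs ≈ sum g xs * a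
  sum-*ʳ g a []       = ≈-sym (zeroˡ a)
  sum-*ʳ g a (x ∷ xs) = ≈-trans (+-congˡ (sum-*ʳ g a xs)) (≈-sym (distribʳ a _ _))

  sum-swap : ∀ (g : A → B → Carrier) xs ys →
             sum (λ x → sum (g x) ys) xs ≈ sum (λ y → sum (λ x → g x y) xs) ys
  sum-swap g []       ys = ≈-sym (sum-zero (All.universal (λ _ → ≈-refl) ys))
  sum-swap g (x ∷ xs) ys = ≈-trans (+-congˡ (sum-swap g xs ys))
    (≈-sym (sum-+ (g x) (λ y → sum (λ x → g x y) xs) ys))

  -- The excess `d` stands on the left so that induction on it removes the last index, which lies
  -- beyond `n`.
  sum-[1…] : ∀ {g : ℕ⁺ → Carrier} {n} → (∀ i → n < toℕ i → g i ≈ 0#) →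
             ∀ d → sum g [1… d ℕ.+ n ] ≈ sum g [1… n ]
  sum-[1…] g≈0 zero = ≈-refl
  sum-[1…] {g} {n} g≈0 (suc d) = begin
    sum g [1… suc (d ℕ.+ n) ]                                ≡⟨ cong (sum g) ([1…]-suc (d ℕ.+ n)) ⟩
    sum g ([1… d ℕ.+ n ] ++ 1+ (d ℕ.+ n) ∷ [])               ≈⟨ sum-++ g [1… d ℕ.+ n ] _ ⟩
    sum g [1… d ℕ.+ n ] + (g (1+ (d ℕ.+ n)) + 0#)            ≈⟨ +-cong (sum-[1…] g≈0 d)
                                                                  (+-congʳ (g≈0 _ (ℕ.s≤s (ℕ.m≤n+m n d)))) ⟩
    sum g [1… n ] + (0# + 0#)                                ≈⟨ +-congˡ (+-identityˡ 0#) ⟩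
    sum g [1… n ] + 0#                                       ≈⟨ +-identityʳ _ ⟩
    sum g [1… n ]                                            ∎

  -- Indicator values and sums over duplicate-free lists of blocks

  restrict : Dec P → Carrier → Carrier
  restrict P? x = if does P? then x else 0#

  restrict-yes : ∀ (P? : Dec P) x → P → restrict P? x ≈ x
  restrict-yes (yes _) x _ = ≈-refl
  restrict-yes (no ¬p) x p = contradiction p ¬p

  restrict-no : ∀ (P? : Dec P) x → ¬ P → restrict P? x ≈ 0#
  restrict-no (yes p) x ¬p = contradiction p ¬p
  restrict-no (no _)  x _  = ≈-refl

  restrict-cong : ∀ (P? : Dec P) (Q? : Dec Q) {x y} → (P → Q) → (Q → P) → (P → x ≈ y) →
                  restrict P? x ≈ restrict Q? y
  restrict-cong (yes p) Q? {y = y} P⇒Q Q⇒P x≈y = ≈-trans (x≈y p) (≈-sym (restrict-yes Q? y (P⇒Q p)))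
  restrict-cong (no ¬p) Q? {y = y} P⇒Q Q⇒P x≈y = ≈-sym (restrict-no Q? y (¬p ∘ Q⇒P))

  *-restrict : ∀ (P? : Dec P) a x → a * restrict P? x ≈ restrict P? (a * x)
  *-restrict (yes _) a x = ≈-refl
  *-restrict (no _)  a x = zeroʳ a

  restrict-* : ∀ (P? : Dec P) x a → restrict P? x * a ≈ restrict P? (x * a)
  restrict-* (yes _) x a = ≈-refl
  restrict-* (no _)  x a = zeroˡ a

  -- Membership is up to `≈ᴮ`, so a duplicate-free `S` holds at most one representative of the class
  -- of `b`. If it holds none, the sum is empty of contributions and the last hypothesis makes `g b`
  -- zero as well.
  sum-δ : ∀ {S} → Unique S → ∀ {g : Block → Carrier} → (∀ {b b′} → b ≈ᴮ b′ → g b ≈ g b′) →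
          ∀ b → (b ∉ᴮ S → g b ≈ 0#) → sum (λ b′ → restrict (b ≟ᴮ b′) (g b′)) S ≈ g b
  sum-δ [] g-cong b g≈0 = ≈-sym (g≈0 λ ())
  sum-δ {b′ ∷ S} (b′∉S ∷ uniq) {g} g-cong b g≈0 with b ≟ᴮ b′
  ... | yes b≈b′ = begin
    restrict (b ≟ᴮ b′) (g b′) + sum (λ b″ → restrict (b ≟ᴮ b″) (g b″)) S
      ≈⟨ +-cong (restrict-yes (b ≟ᴮ b′) _ b≈b′) (sum-zero (All.map
           (λ b′≉b″ → restrict-no (b ≟ᴮ _) _ (b′≉b″ ∘ ≈ᴮ.trans (≈ᴮ.sym b≈b′))) b′∉S)) ⟩
    g b′ + 0#
      ≈⟨ +-identityʳ _ ⟩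
    g b′
      ≈⟨ g-cong b≈b′ ⟨
    g b
      ∎
  ... | no b≉b′ = ≈-trans (≈-trans (+-congʳ (restrict-no (b ≟ᴮ b′) _ b≉b′)) (+-identityˡ _))
    (sum-δ uniq g-cong b λ b∉S → g≈0 λ { (here b≈b′) → b≉b′ b≈b′ ; (there b∈S) → b∉S b∈S })

  sum-support : ∀ {S S′} → Unique S → Unique S′ →
                ∀ {g : Block → Carrier} → (∀ {b b′} → b ≈ᴮ b′ → g b ≈ g b′) →
                (∀ b → b ∉ᴮ S → g b ≈ 0#) → (∀ b → b ∉ᴮ S′ → g b ≈ 0#) → sum g S ≈ sum g S′
  sum-support {S} {S′} uniq uniq′ {g} g-cong g≈0 g≈0′ = begin
    sum g S
      ≈⟨ sum-cong (λ b → sum-δ uniq′ g-cong b (g≈0′ b)) S ⟨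
    sum (λ b → sum (λ b′ → restrict (b ≟ᴮ b′) (g b′)) S′) S
      ≈⟨ sum-swap (λ b b′ → restrict (b ≟ᴮ b′) (g b′)) S S′ ⟩
    sum (λ b′ → sum (λ b → restrict (b ≟ᴮ b′) (g b′)) S) S′
      ≈⟨ sum-cong (λ b′ → sum-cong (λ b → flip-δ b b′) S) S′ ⟩
    sum (λ b′ → sum (λ b → restrict (b′ ≟ᴮ b) (g b)) S) S′
      ≈⟨ sum-cong (λ b′ → sum-δ uniq g-cong b′ (g≈0 b′)) S′ ⟩
    sum g S′
      ∎
    where
    flip-δ : ∀ b b′ → restrict (b ≟ᴮ b′) (g b′) ≈ restrict (b′ ≟ᴮ b) (g b)
    flip-δ b b′ = restrict-cong (b ≟ᴮ b′) (b′ ≟ᴮ b) ≈ᴮ.sym ≈ᴮ.sym (λ b≈b′ → g-cong (≈ᴮ.sym b≈b′))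

  -- Coefficients of sums, scalar multiples and products with monomials

  coeff-∷ : ∀ a J f I → coeff ((a , J) ∷ f) I ≈ restrict (J ↭? I) a + coeff f I
  coeff-∷ a J f I with does (J ↭? I)
  ... | true  = ≈-refl
  ... | false = ≈-sym (+-identityˡ _)

  coeff-↭ : ∀ f {I J} → I ↭ J → coeff f I ≈ coeff f J
  coeff-↭ []            I↭J = ≈-refl
  coeff-↭ ((a , K) ∷ f) {I} {J} I↭J = begin
    coeff ((a , K) ∷ f) I                 ≈⟨ coeff-∷ a K f I ⟩
    restrict (K ↭? I) a + coeff f I       ≈⟨ +-cong
      (restrict-cong (K ↭? I) (K ↭? J)
        (λ K↭I → ↭-trans K↭I I↭J) (λ K↭J → ↭-trans K↭J (↭-sym I↭J)) (λ _ → ≈-refl))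
      (coeff-↭ f I↭J) ⟩
    restrict (K ↭? J) a + coeff f J       ≈⟨ coeff-∷ a K f J ⟨
    coeff ((a , K) ∷ f) J                 ∎

  coeff-++ : ∀ f g I → coeff (f ++ g) I ≈ coeff f I + coeff g I
  coeff-++ []            g I = ≈-sym (+-identityˡ _)
  coeff-++ ((a , J) ∷ f) g I = begin
    coeff ((a , J) ∷ f ++ g) I                         ≈⟨ coeff-∷ a J (f ++ g) I ⟩
    restrict (J ↭? I) a + coeff (f ++ g) I             ≈⟨ +-congˡ (coeff-++ f g I) ⟩
    restrict (J ↭? I) a + (coeff f I + coeff g I)      ≈⟨ +-assoc _ _ _ ⟨
    (restrict (J ↭? I) a + coeff f I) + coeff g I      ≈⟨ +-congʳ (coeff-∷ a J f I) ⟨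
    coeff ((a , J) ∷ f) I + coeff g I                  ∎

  coeff-· : ∀ c (f : Λ) I → coeff (map (map₁ (c *_)) f) I ≈ c * coeff f I
  coeff-· c []            I = ≈-sym (zeroʳ c)
  coeff-· c ((a , J) ∷ f) I = begin
    coeff (map (map₁ (c *_)) ((a , J) ∷ f)) I                      ≈⟨ coeff-∷ (c * a) J (map (map₁ (c *_)) f) I ⟩
    restrict (J ↭? I) (c * a) + coeff (map (map₁ (c *_)) f) I      ≈⟨ +-cong (≈-sym (*-restrict (J ↭? I) c a))
                                                                             (coeff-· c f I) ⟩
    c * restrict (J ↭? I) a + c * coeff f I                        ≈⟨ distribˡ c _ _ ⟨
    c * (restrict (J ↭? I) a + coeff f I)                          ≈⟨ *-congˡ (coeff-∷ a J f I) ⟨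
    c * coeff ((a , J) ∷ f) I                                      ∎

  coeff-concatMap : ∀ (T : A → Λ) xs I → coeff (concatMap T xs) I ≈ sum (λ x → coeff (T x) I) xs
  coeff-concatMap T []       I = ≈-refl
  coeff-concatMap T (x ∷ xs) I =
    ≈-trans (coeff-++ (T x) (concatMap T xs) I) (+-congˡ (coeff-concatMap T xs I))

  p*-[] : ∀ I → p* I [] ≡ []
  p*-[] []      = ≡.refl
  p*-[] (i ∷ I) = cong (p i) (p*-[] I)

  p*-∷ : ∀ I a J f → p* I ((a , J) ∷ f) ≡ (a , I ++ J) ∷ p* I f
  p*-∷ []      a J f = ≡.refl
  p*-∷ (i ∷ I) a J f = cong (p i) (p*-∷ I a J f)

  -- By cancellation, I ⊎ J = M = I ⊎ K holds exactly when J = K. The cofactor `K` is any multiset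
  -- with this property, since coefficients depend on monomials only up to `↭`.
  coeff-p*-++ : ∀ I f {K M} → I ++ K ↭ M → coeff (p* I f) M ≈ coeff f K
  coeff-p*-++ I []            {M = M} IK↭M = reflexive (cong (λ g → coeff g M) (p*-[] I))
  coeff-p*-++ I ((a , J) ∷ f) {K} {M} IK↭M = begin
    coeff (p* I ((a , J) ∷ f)) M                         ≡⟨ cong (λ g → coeff g M) (p*-∷ I a J f) ⟩
    coeff ((a , I ++ J) ∷ p* I f) M                      ≈⟨ coeff-∷ a (I ++ J) (p* I f) M ⟩
    restrict (I ++ J ↭? M) a + coeff (p* I f) M          ≈⟨ +-cong
      (restrict-cong (I ++ J ↭? M) (J ↭? K)
        (λ IJ↭M → ++-cancelˡ I (↭-trans IJ↭M (↭-sym IK↭M)))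
        (λ J↭K → ↭-trans (↭.++⁺ˡ I J↭K) IK↭M) (λ _ → ≈-refl))
      (coeff-p*-++ I f IK↭M) ⟩
    restrict (J ↭? K) a + coeff f K                      ≈⟨ coeff-∷ a J f K ⟨
    coeff ((a , J) ∷ f) K                                ∎

  coeff-p*-∄ : ∀ I f {M} → ¬ (∃ λ K → I ++ K ↭ M) → coeff (p* I f) M ≈ 0#
  coeff-p*-∄ I []            {M} ∄K = reflexive (cong (λ g → coeff g M) (p*-[] I))
  coeff-p*-∄ I ((a , J) ∷ f) {M} ∄K = begin
    coeff (p* I ((a , J) ∷ f)) M                         ≡⟨ cong (λ g → coeff g M) (p*-∷ I a J f) ⟩
    coeff ((a , I ++ J) ∷ p* I f) M                      ≈⟨ coeff-∷ a (I ++ J) (p* I f) M ⟩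
    restrict (I ++ J ↭? M) a + coeff (p* I f) M          ≈⟨ +-cong
      (restrict-no (I ++ J ↭? M) a (λ IJ↭M → ∄K (J , IJ↭M))) (coeff-p*-∄ I f ∄K) ⟩
    0# + 0#                                              ≈⟨ +-identityˡ 0# ⟩
    0#                                                   ∎

  p*-cong : ∀ {I I′ f f′} → I ↭ I′ → f ≈ᴸ f′ → p* I f ≈ᴸ p* I′ f′
  p*-cong {I} {I′} {f} {f′} I↭I′ f≈f′ M with difference I M
  ... | yes (K , IK↭M) = begin
    coeff (p* I f) M      ≈⟨ coeff-p*-++ I f IK↭M ⟩
    coeff f K             ≈⟨ f≈f′ K ⟩
    coeff f′ K            ≈⟨ coeff-p*-++ I′ f′ (↭-trans (↭.++⁺ʳ K (↭-sym I↭I′)) IK↭M) ⟨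
    coeff (p* I′ f′) M    ∎
  ... | no ∄K = begin
    coeff (p* I f) M      ≈⟨ coeff-p*-∄ I f ∄K ⟩
    0#                    ≈⟨ coeff-p*-∄ I′ f′ (λ (K , IK↭M) → ∄K (K , ↭-trans (↭.++⁺ʳ K I↭I′) IK↭M)) ⟨
    coeff (p* I′ f′) M    ∎

  -- Coefficients of derivatives

  terms-∷ : ∀ (a : Carrier) j (Ks : List Multiset) → map (a ,_) (map (j ∷_) Ks) ≡ p j (map (a ,_) Ks)
  terms-∷ a j []       = ≡.refl
  terms-∷ a j (K ∷ Ks) = cong ((a , j ∷ K) ∷_) (terms-∷ a j Ks)

  coeff-p-∉ : ∀ {k} f {I} → k ∉ I → coeff (p k f) I ≈ 0#
  coeff-p-∉ {k} f k∉I =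
    coeff-p*-∄ (k ∷ []) f λ (K , kK↭I) → k∉I (↭.∈-resp-↭ kK↭I (here ≡.refl))

  -- The derivative of p_J contains p_I only if J = k ⊎ I, and then once for each occurrence of `k`
  -- in `J`. That number is expressed through the target `I`, as `suc (mult k I)`, so that the
  -- factor is the same for every source term.
  coeff-∂-monomial : ∀ a k J I → coeff (map (a ,_) (∂-monomial k J)) I ≈
                                 restrict (J ↭? k ∷ I) (ι (suc (mult k I)) * a)
  coeff-∂-monomial a k []      I = ≈-sym
    (restrict-no ([] ↭? k ∷ I) (ι (suc (mult k I)) * a) (↭.¬x∷xs↭[] ∘ ↭-sym))
  coeff-∂-monomial a k (j ∷ J) I with k ≟⁺ j
  -- The head contributes the monomial `J`. Later occurrences of `k` contribute monomials that still
  -- contain the head `k`, so they reach p_I only if `k` can be removed from `I`.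
  ... | yes ≡.refl with remove k I
  ...   | inj₁ (K , kK↭I) = begin
    coeff ((a , J) ∷ map (a ,_) (map (k ∷_) (∂-monomial k J))) I
      ≡⟨ cong (λ g → coeff ((a , J) ∷ g) I) (terms-∷ a k (∂-monomial k J)) ⟩
    coeff ((a , J) ∷ p k (map (a ,_) (∂-monomial k J))) I
      ≈⟨ coeff-∷ a J (p k (map (a ,_) (∂-monomial k J))) I ⟩
    restrict (J ↭? I) a + coeff (p k (map (a ,_) (∂-monomial k J))) I
      ≈⟨ +-congˡ (coeff-p*-++ (k ∷ []) (map (a ,_) (∂-monomial k J)) kK↭I) ⟩
    restrict (J ↭? I) a + coeff (map (a ,_) (∂-monomial k J)) K
      ≈⟨ +-congˡ (coeff-∂-monomial a k J K) ⟩
    restrict (J ↭? I) a + restrict (J ↭? k ∷ K) (ι (suc (mult k K)) * a)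
      ≈⟨ +-congˡ (restrict-cong (J ↭? k ∷ K) (J ↭? I)
           (λ J↭kK → ↭-trans J↭kK kK↭I) (λ J↭I → ↭-trans J↭I (↭-sym kK↭I))
           (λ _ → reflexive (cong (λ m → ι m * a) (≡.trans (≡.sym (mult-≡ k K)) (mult-↭ k kK↭I))))) ⟩
    restrict (J ↭? I) a + restrict (J ↭? I) (ι (mult k I) * a)
      ≈⟨ collect (J ↭? I) ⟩
    restrict (k ∷ J ↭? k ∷ I) (ι (suc (mult k I)) * a)
      ∎
    where
    collect : ∀ (d : Dec (J ↭ I)) → restrict d a + restrict d (ι (mult k I) * a) ≈
                                    restrict (k ∷ J ↭? k ∷ I) (ι (suc (mult k I)) * a)
    collect (yes J↭I) = begin
      a + ι (mult k I) * a                    ≈⟨ +-congʳ (*-identityˡ a) ⟨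
      1# * a + ι (mult k I) * a               ≈⟨ distribʳ a 1# _ ⟨
      ι (suc (mult k I)) * a                  ≈⟨ restrict-yes (k ∷ J ↭? k ∷ I) _ (↭.prep k J↭I) ⟨
      restrict (k ∷ J ↭? k ∷ I) _             ∎
    collect (no J↭̸I) = ≈-trans (+-identityˡ 0#) (≈-sym (restrict-no (k ∷ J ↭? k ∷ I) _ (J↭̸I ∘ ↭.drop-∷)))
  ...   | inj₂ k∉I = begin
    coeff ((a , J) ∷ map (a ,_) (map (k ∷_) (∂-monomial k J))) I
      ≡⟨ cong (λ g → coeff ((a , J) ∷ g) I) (terms-∷ a k (∂-monomial k J)) ⟩
    coeff ((a , J) ∷ p k (map (a ,_) (∂-monomial k J))) I
      ≈⟨ coeff-∷ a J (p k (map (a ,_) (∂-monomial k J))) I ⟩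
    restrict (J ↭? I) a + coeff (p k (map (a ,_) (∂-monomial k J))) I
      ≈⟨ +-congˡ (coeff-p-∉ (map (a ,_) (∂-monomial k J)) k∉I) ⟩
    restrict (J ↭? I) a + 0#
      ≈⟨ +-identityʳ _ ⟩
    restrict (J ↭? I) a
      ≈⟨ restrict-cong (J ↭? I) (k ∷ J ↭? k ∷ I) (↭.prep k) ↭.drop-∷ (λ _ → a≈) ⟩
    restrict (k ∷ J ↭? k ∷ I) (ι (suc (mult k I)) * a)
      ∎
    where
    a≈ : a ≈ ι (suc (mult k I)) * a
    a≈ = begin
      a                         ≈⟨ *-identityˡ a ⟨
      1# * a                    ≈⟨ *-congʳ (+-identityʳ 1#) ⟨
      ι 1 * a                   ≡⟨ cong (λ m → ι (suc m) * a) (mult-∉ I k∉I) ⟨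
      ι (suc (mult k I)) * a    ∎
  -- All monomials produced here keep the factor `j`. It is cancelled from `I` if it occurs there;
  -- otherwise both sides vanish, because `j` is neither `k` nor in `I`.
  coeff-∂-monomial a k (j ∷ J) I | no k≢j with remove j I
  ...   | inj₁ (K , jK↭I) = begin
    coeff (map (a ,_) (map (j ∷_) (∂-monomial k J))) I
      ≡⟨ cong (λ g → coeff g I) (terms-∷ a j (∂-monomial k J)) ⟩
    coeff (p j (map (a ,_) (∂-monomial k J))) I
      ≈⟨ coeff-p*-++ (j ∷ []) (map (a ,_) (∂-monomial k J)) jK↭I ⟩
    coeff (map (a ,_) (∂-monomial k J)) K
      ≈⟨ coeff-∂-monomial a k J K ⟩
    restrict (J ↭? k ∷ K) (ι (suc (mult k K)) * a)
      ≈⟨ restrict-cong (J ↭? k ∷ K) (j ∷ J ↭? k ∷ I)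
           (λ J↭kK → ↭-trans (↭.prep j J↭kK) jkK↭kI)
           (λ jJ↭kI → ↭.drop-∷ (↭-trans jJ↭kI (↭-sym jkK↭kI)))
           (λ _ → reflexive (cong (λ m → ι (suc m) * a) (≡.trans (≡.sym (mult-≢ K k≢j)) (mult-↭ k jK↭I)))) ⟩
    restrict (j ∷ J ↭? k ∷ I) (ι (suc (mult k I)) * a)
      ∎
    where
    jkK↭kI : j ∷ k ∷ K ↭ k ∷ I
    jkK↭kI = ↭-trans (↭.swap j k ↭-refl) (↭.prep k jK↭I)
  ...   | inj₂ j∉I = begin
    coeff (map (a ,_) (map (j ∷_) (∂-monomial k J))) I
      ≡⟨ cong (λ g → coeff g I) (terms-∷ a j (∂-monomial k J)) ⟩
    coeff (p j (map (a ,_) (∂-monomial k J))) I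
      ≈⟨ coeff-p-∉ (map (a ,_) (∂-monomial k J)) j∉I ⟩
    0#
      ≈⟨ restrict-no (j ∷ J ↭? k ∷ I) _ j∷J↭̸k∷I ⟨
    restrict (j ∷ J ↭? k ∷ I) (ι (suc (mult k I)) * a)
      ∎
    where
    j∷J↭̸k∷I : ¬ (j ∷ J ↭ k ∷ I)
    j∷J↭̸k∷I jJ↭kI with ↭.∈-resp-↭ jJ↭kI (here ≡.refl)
    ... | here j≡k  = k≢j (≡.sym j≡k)
    ... | there j∈I = j∉I j∈I

  -- The right-hand side involves only the coefficient function of `f`, not the list representing
  -- it. Compatibility of D with `≈ᴸ` and commutation of the D's are read off from this formula.
  coeff-∂ : ∀ k f I → coeff (∂ k f) I ≈ ι (suc (mult k I)) * coeff f (k ∷ I)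
  coeff-∂ k []            I = ≈-sym (zeroʳ _)
  coeff-∂ k ((a , J) ∷ f) I = begin
    coeff (map (a ,_) (∂-monomial k J) ++ ∂ k f) I
      ≈⟨ coeff-++ (map (a ,_) (∂-monomial k J)) (∂ k f) I ⟩
    coeff (map (a ,_) (∂-monomial k J)) I + coeff (∂ k f) I
      ≈⟨ +-cong (coeff-∂-monomial a k J I) (coeff-∂ k f I) ⟩
    restrict (J ↭? k ∷ I) (ι (suc (mult k I)) * a) + ι (suc (mult k I)) * coeff f (k ∷ I)
      ≈⟨ +-congʳ (*-restrict (J ↭? k ∷ I) _ a) ⟨
    ι (suc (mult k I)) * restrict (J ↭? k ∷ I) a + ι (suc (mult k I)) * coeff f (k ∷ I)
      ≈⟨ distribˡ _ _ _ ⟨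
    ι (suc (mult k I)) * (restrict (J ↭? k ∷ I) a + coeff f (k ∷ I))
      ≈⟨ *-congˡ (coeff-∷ a J f (k ∷ I)) ⟨
    ι (suc (mult k I)) * coeff ((a , J) ∷ f) (k ∷ I)
      ∎

  coeff-D : ∀ k f I → coeff (D k f) I ≈ ι (toℕ k) * (ι (suc (mult k I)) * coeff f (k ∷ I))
  coeff-D k f I = ≈-trans (coeff-· (ι (toℕ k)) (∂ k f) I) (*-congˡ (coeff-∂ k f I))

  D-cong : ∀ k f g → f ≈ᴸ g → D k f ≈ᴸ D k g
  D-cong k f g f≈g I = begin
    coeff (D k f) I                                            ≈⟨ coeff-D k f I ⟩
    ι (toℕ k) * (ι (suc (mult k I)) * coeff f (k ∷ I))         ≈⟨ *-congˡ (*-congˡ (f≈g (k ∷ I))) ⟩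
    ι (toℕ k) * (ι (suc (mult k I)) * coeff g (k ∷ I))         ≈⟨ coeff-D k g I ⟨
    coeff (D k g) I                                            ∎

  -- Adding `j` to the target leaves the multiplicity of `k` unchanged when `j ≢ k`, so the scalar
  -- factor is symmetric in `j` and `k`.
  coeff-D-D : ∀ {j k} → j ≢ k → ∀ f I → coeff (D j (D k f)) I ≈
    ι (toℕ j) * (ι (suc (mult j I)) * (ι (toℕ k) * (ι (suc (mult k I)) * coeff f (k ∷ j ∷ I))))
  coeff-D-D {j} {k} j≢k f I = begin
    coeff (D j (D k f)) I
      ≈⟨ coeff-D j (D k f) I ⟩
    ι (toℕ j) * (ι (suc (mult j I)) * coeff (D k f) (j ∷ I))
      ≈⟨ *-congˡ (*-congˡ (coeff-D k f (j ∷ I))) ⟩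
    ι (toℕ j) * (ι (suc (mult j I)) * (ι (toℕ k) * (ι (suc (mult k (j ∷ I))) * coeff f (k ∷ j ∷ I))))
      ≡⟨ cong (λ m → ι (toℕ j) * (ι (suc (mult j I)) * (ι (toℕ k) * (ι (suc m) * coeff f (k ∷ j ∷ I)))))
           (mult-≢ I (j≢k ∘ ≡.sym)) ⟩
    ι (toℕ j) * (ι (suc (mult j I)) * (ι (toℕ k) * (ι (suc (mult k I)) * coeff f (k ∷ j ∷ I))))
      ∎

  D-comm : ∀ j k f → D j (D k f) ≈ᴸ D k (D j f)
  D-comm j k f I with j ≟⁺ k
  ... | yes ≡.refl = ≈-refl
  ... | no j≢k = begin
    coeff (D j (D k f)) I
      ≈⟨ coeff-D-D j≢k f I ⟩
    ι (toℕ j) * (ι (suc (mult j I)) * (ι (toℕ k) * (ι (suc (mult k I)) * coeff f (k ∷ j ∷ I))))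
      ≈⟨ *-congˡ (*-congˡ (*-congˡ (*-congˡ (coeff-↭ f (↭.swap k j ↭-refl))))) ⟩
    ι (toℕ j) * (ι (suc (mult j I)) * (ι (toℕ k) * (ι (suc (mult k I)) * coeff f (j ∷ k ∷ I))))
      ≈⟨ solve 5 (λ a b c d x → a :* (b :* (c :* (d :* x))) := c :* (d :* (a :* (b :* x)))) ≈-refl
           (ι (toℕ j)) (ι (suc (mult j I))) (ι (toℕ k)) (ι (suc (mult k I))) (coeff f (j ∷ k ∷ I)) ⟩
    ι (toℕ k) * (ι (suc (mult k I)) * (ι (toℕ j) * (ι (suc (mult j I)) * coeff f (j ∷ k ∷ I))))
      ≈⟨ coeff-D-D (j≢k ∘ ≡.sym) f I ⟨
    coeff (D k (D j f)) I
      ∎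

  D*-↭ : ∀ {J K} → J ↭ K → ∀ f → D* J f ≈ᴸ D* K f
  D*-↭ ↭.refl            f I = ≈-refl
  D*-↭ (↭.prep {J} {K} j J↭K) f I = D-cong j (D* J f) (D* K f) (D*-↭ J↭K f) I
  D*-↭ (↭.swap {J} {K} j k J↭K) f I = ≈-trans (D-comm j k (D* J f) I)
    (D-cong k (D j (D* J f)) (D j (D* K f)) (D-cong j (D* J f) (D* K f) (D*-↭ J↭K f)) I)
  D*-↭ (↭.trans J↭K K↭L) f I = ≈-trans (D*-↭ J↭K f I) (D*-↭ K↭L f I)

  -- Each D contributes its subscript and a multiplicity. The product is independent of `f`, and
  -- only its being a positive integer matters later, so its value stays existential.
  coeff-D* : ∀ J I → ∃ λ n → ∀ f → coeff (D* J f) I ≈ ι (suc n) * coeff f (J ++ I)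
  coeff-D* []      I = 0 , λ f → ≈-trans (≈-sym (*-identityˡ _)) (*-congʳ (≈-sym (+-identityʳ 1#)))
  coeff-D* (j ∷ J) I with coeff-D* J (j ∷ I)
  -- All three factors are successors, so `suc` of this predecessor computes to their product.
  ... | n , eq = ℕ.pred (toℕ j ℕ.* (suc (mult j I) ℕ.* suc n)) , λ f → begin
    coeff (D j (D* J f)) I
      ≈⟨ coeff-D j (D* J f) I ⟩
    ι (toℕ j) * (ι (suc (mult j I)) * coeff (D* J f) (j ∷ I))
      ≈⟨ *-congˡ (*-congˡ (eq f)) ⟩
    ι (toℕ j) * (ι (suc (mult j I)) * (ι (suc n) * coeff f (J ++ j ∷ I)))
      ≈⟨ *-congˡ (*-assoc _ _ _) ⟨
    ι (toℕ j) * (ι (suc (mult j I)) * ι (suc n) * coeff f (J ++ j ∷ I))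
      ≈⟨ *-assoc _ _ _ ⟨
    ι (toℕ j) * (ι (suc (mult j I)) * ι (suc n)) * coeff f (J ++ j ∷ I)
      ≈⟨ *-congʳ (*-congˡ (×1-homo-* (suc (mult j I)) (suc n))) ⟨
    ι (toℕ j) * ι (suc (mult j I) ℕ.* suc n) * coeff f (J ++ j ∷ I)
      ≈⟨ *-congʳ (×1-homo-* (toℕ j) (suc (mult j I) ℕ.* suc n)) ⟨
    ι (toℕ j ℕ.* (suc (mult j I) ℕ.* suc n)) * coeff f (J ++ j ∷ I)
      ≈⟨ *-congˡ (coeff-↭ f (↭.shift j J I)) ⟩
    ι (toℕ j ℕ.* (suc (mult j I) ℕ.* suc n)) * coeff f (j ∷ J ++ I)
      ∎

  -- The action of a block on a polynomial

  bound-D* : ∀ J f → bound (D* J f) ≤ bound f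
  bound-D* []      f = ℕ.≤-refl
  bound-D* (j ∷ J) f = ℕ.≤-trans
    (maximum-≤ (All.tabulate λ i∈ → All.lookup (≤-maximum (indices (D* J f))) (indices-D j (D* J f) i∈)))
    (bound-D* J f)

  D*-vanishes : ∀ J f → Any (λ j → bound f < toℕ j) J → D* J f ≡ []
  D*-vanishes (j ∷ J) f (here f<j)  = D-vanishes j (D* J f) (ℕ.≤-<-trans (bound-D* J f) f<j)
  D*-vanishes (j ∷ J) f (there f<J) = cong (D j) (D*-vanishes J f f<J)

  -- The number that multiplies c(I,J) in the p_M-coefficient of the image of `f`. An expansion
  -- thereby becomes a family of linear equations for its coefficients, one for each `f` and `M`.
  action : Λ → Multiset → Block → Carrier
  action f M (I , J) = coeff (p* I (D* J f)) M

  action-cong : ∀ f M {b b′} → b ≈ᴮ b′ → action f M b ≈ action f M b′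
  action-cong f M (I↭I′ , J↭J′) = p*-cong I↭I′ (D*-↭ J↭J′ f) M

  action-vanishes : ∀ f M I J → Any (λ j → bound f < toℕ j) J → action f M (I , J) ≈ 0#
  action-vanishes f M I J f<J =
    reflexive (cong (λ g → coeff g M) (≡.trans (cong (p* I) (D*-vanishes J f f<J)) (p*-[] I)))

  All-concatMap⁻ : ∀ {A B : Set} {P : B → Set} (f : A → List B) xs →
                   All P (concatMap f xs) → All (λ x → All P (f x)) xs
  All-concatMap⁻ f xs ps = All.map⁻ (All.concat⁻ {xss = map f xs} ps)

  coeff-summand : ∀ a f M I J → coeff ((a · p* I ∘ D* J) f) M ≈ a * action f M (I , J)
  coeff-summand a f M I J = coeff-· a (p* I (D* J f)) M

  -- Syntax for operators in normal order, and their expansions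

  infixl 6 _⊞_
  infixr 8 _⊡_

  data Expr : Set where
    block : Block → Expr
    _⊞_   : Expr → Expr → Expr
    _⊡_   : Carrier → Expr → Expr
    ∑     : (ℕ⁺ → Expr) → Expr

  ⟦_⟧ : Expr → Op
  ⟦ block (I , J) ⟧ = p* I ∘ D* J
  ⟦ e ⊞ e′ ⟧        = ⟦ e ⟧ ⊕ ⟦ e′ ⟧
  ⟦ a ⊡ e ⟧         = a · ⟦ e ⟧
  ⟦ ∑ e ⟧           = ∑⁺ λ i → ⟦ e i ⟧

  -- Here and in blocks, every summation index is truncated at n.
  coefficient : Expr → ℕ → Block → Carrier
  coefficient (block b′) n b = restrict (b′ ≟ᴮ b) 1#
  coefficient (e ⊞ e′)   n b = coefficient e n b + coefficient e′ n b
  coefficient (a ⊡ e)    n b = a * coefficient e n b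
  coefficient (∑ e)      n b = sum (λ i → coefficient (e i) n b) [1… n ]

  blocks : Expr → ℕ → List Block
  blocks (block b) n = b ∷ []
  blocks (e ⊞ e′)  n = blocks e n ++ blocks e′ n
  blocks (a ⊡ e)   n = blocks e n
  blocks (∑ e)     n = concatMap (λ i → blocks (e i) n) [1… n ]

  coefficient-cong : ∀ e n {b b′} → b ≈ᴮ b′ → coefficient e n b ≈ coefficient e n b′
  coefficient-cong (block b″) n {b} {b′} b≈b′ = restrict-cong (b″ ≟ᴮ b) (b″ ≟ᴮ b′)
    (λ b″≈b → ≈ᴮ.trans b″≈b b≈b′) (λ b″≈b′ → ≈ᴮ.trans b″≈b′ (≈ᴮ.sym b≈b′)) (λ _ → ≈-refl)
  coefficient-cong (e ⊞ e′) n b≈b′ = +-cong (coefficient-cong e n b≈b′) (coefficient-cong e′ n b≈b′)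
  coefficient-cong (a ⊡ e)  n b≈b′ = *-congˡ (coefficient-cong e n b≈b′)
  coefficient-cong (∑ e)    n b≈b′ = sum-cong (λ i → coefficient-cong (e i) n b≈b′) [1… n ]

  coefficient-outside : ∀ e n {b} → All (λ b′ → ¬ b ≈ᴮ b′) (blocks e n) → coefficient e n b ≈ 0#
  coefficient-outside (block b′) n {b} (b≉b′ ∷ []) = restrict-no (b′ ≟ᴮ b) 1# (b≉b′ ∘ ≈ᴮ.sym)
  coefficient-outside (e ⊞ e′) n b∉ = ≈-trans
    (+-cong (coefficient-outside e n (All.++⁻ˡ (blocks e n) b∉))
            (coefficient-outside e′ n (All.++⁻ʳ (blocks e n) b∉)))
    (+-identityˡ 0#)
  coefficient-outside (a ⊡ e) n b∉ = ≈-trans (*-congˡ (coefficient-outside e n b∉)) (zeroʳ a)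
  coefficient-outside (∑ e) n b∉ =
    sum-zero (All.map (λ {i} → coefficient-outside (e i) n) (All-concatMap⁻ (λ i → blocks (e i) n) [1… n ] b∉))

  -- `S` is any duplicate-free list that meets the class of every block of `e`, rather than the list
  -- of blocks itself, so that one `S` serves all subexpressions in the induction. Nested sums are
  -- evaluated at the same `f`, hence all their indices are truncated at the same `bound f`.
  ⟦⟧-expansion : ∀ e f M {S} → Unique S → All (λ b → ¬ b ∉ᴮ S) (blocks e (bound f)) →
    coeff (⟦ e ⟧ f) M ≈ sum (λ b → coefficient e (bound f) b * action f M b) S
  ⟦⟧-expansion (block b′) f M {S} uniq (b′∈S ∷ []) = begin
    action f M b′
      ≈⟨ sum-δ uniq (action-cong f M) b′ (λ b′∉S → contradiction b′∉S b′∈S) ⟨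
    sum (λ b → restrict (b′ ≟ᴮ b) (action f M b)) S
      ≈⟨ sum-cong (λ b → restrict-cong (b′ ≟ᴮ b) (b′ ≟ᴮ b) id id (λ _ → *-identityˡ _)) S ⟨
    sum (λ b → restrict (b′ ≟ᴮ b) (1# * action f M b)) S
      ≈⟨ sum-cong (λ b → restrict-* (b′ ≟ᴮ b) 1# (action f M b)) S ⟨
    sum (λ b → restrict (b′ ≟ᴮ b) 1# * action f M b) S
      ∎
  ⟦⟧-expansion (e ⊞ e′) f M {S} uniq b∈S = begin
    coeff (⟦ e ⟧ f ++ ⟦ e′ ⟧ f) M
      ≈⟨ coeff-++ (⟦ e ⟧ f) (⟦ e′ ⟧ f) M ⟩
    coeff (⟦ e ⟧ f) M + coeff (⟦ e′ ⟧ f) M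
      ≈⟨ +-cong (⟦⟧-expansion e f M uniq (All.++⁻ˡ (blocks e n) b∈S))
                (⟦⟧-expansion e′ f M uniq (All.++⁻ʳ (blocks e n) b∈S)) ⟩
    sum (λ b → coefficient e n b * action f M b) S + sum (λ b → coefficient e′ n b * action f M b) S
      ≈⟨ sum-+ (λ b → coefficient e n b * action f M b) (λ b → coefficient e′ n b * action f M b) S ⟨
    sum (λ b → coefficient e n b * action f M b + coefficient e′ n b * action f M b) S
      ≈⟨ sum-cong (λ b → distribʳ (action f M b) _ _) S ⟨
    sum (λ b → (coefficient e n b + coefficient e′ n b) * action f M b) S
      ∎
    where n = bound f
  ⟦⟧-expansion (a ⊡ e) f M {S} uniq b∈S = begin
    coeff (map (map₁ (a *_)) (⟦ e ⟧ f)) M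
      ≈⟨ coeff-· a (⟦ e ⟧ f) M ⟩
    a * coeff (⟦ e ⟧ f) M
      ≈⟨ *-congˡ (⟦⟧-expansion e f M uniq b∈S) ⟩
    a * sum (λ b → coefficient e n b * action f M b) S
      ≈⟨ sum-*ˡ a (λ b → coefficient e n b * action f M b) S ⟨
    sum (λ b → a * (coefficient e n b * action f M b)) S
      ≈⟨ sum-cong (λ b → *-assoc a _ (action f M b)) S ⟨
    sum (λ b → a * coefficient e n b * action f M b) S
      ∎
    where n = bound f
  ⟦⟧-expansion (∑ e) f M {S} uniq b∈S = begin
    coeff (concatMap (λ i → ⟦ e i ⟧ f) [1… n ]) M
      ≈⟨ coeff-concatMap (λ i → ⟦ e i ⟧ f) [1… n ] M ⟩
    sum (λ i → coeff (⟦ e i ⟧ f) M) [1… n ]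
      ≈⟨ sum-cong-All (All.map (λ {i} → ⟦⟧-expansion (e i) f M uniq)
           (All-concatMap⁻ (λ i → blocks (e i) n) [1… n ] b∈S)) ⟩
    sum (λ i → sum (λ b → coefficient (e i) n b * action f M b) S) [1… n ]
      ≈⟨ sum-swap (λ i b → coefficient (e i) n b * action f M b) [1… n ] S ⟩
    sum (λ b → sum (λ i → coefficient (e i) n b * action f M b) [1… n ]) S
      ≈⟨ sum-cong (λ b → sum-*ʳ (λ i → coefficient (e i) n b) (action f M b) [1… n ]) S ⟩
    sum (λ b → sum (λ i → coefficient (e i) n b) [1… n ] * action f M b) S
      ∎
    where n = bound f

  -- D k f = 0 for k > bound f, so a summand with index i contributes to a truncated sum only
  -- finitely often if each of its blocks has a D whose subscript is at least i.
  Dominates : ℕ⁺ → Expr → Set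
  Dominates i (block (I , J)) = Any (λ j → toℕ i ≤ toℕ j) J
  Dominates i (e ⊞ e′)        = Dominates i e × Dominates i e′
  Dominates i (a ⊡ e)         = Dominates i e
  Dominates i (∑ e)           = ∀ j → Dominates i (e j)

  LocallyFinite : Expr → Set
  LocallyFinite (block b) = ⊤
  LocallyFinite (e ⊞ e′)  = LocallyFinite e × LocallyFinite e′
  LocallyFinite (a ⊡ e)   = LocallyFinite e
  LocallyFinite (∑ e)     = ∀ i → Dominates i (e i) × LocallyFinite (e i)

  coefficient-dominated : ∀ {i} e n {I J} → Dominates i e → All (λ j → toℕ j < toℕ i) J →
                          coefficient e n (I , J) ≈ 0#
  coefficient-dominated {i} (block (I′ , J′)) n {I} {J} i≤J′ J<i =
    restrict-no ((I′ , J′) ≟ᴮ (I , J)) 1# λ (_ , J′↭J) →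
      All.All¬⇒¬Any (All.map ℕ.<⇒≱ J<i) (↭.Any-resp-↭ J′↭J i≤J′)
  coefficient-dominated (e ⊞ e′) n (i≤e , i≤e′) J<i = ≈-trans
    (+-cong (coefficient-dominated e n i≤e J<i) (coefficient-dominated e′ n i≤e′ J<i))
    (+-identityˡ 0#)
  coefficient-dominated (a ⊡ e) n i≤e J<i =
    ≈-trans (*-congˡ (coefficient-dominated e n i≤e J<i)) (zeroʳ a)
  coefficient-dominated (∑ e) n i≤e J<i =
    sum-zero (All.universal (λ j → coefficient-dominated (e j) n (i≤e j) J<i) [1… n ])

  -- Under a `∑`, an index beyond `n` exceeds every entry of `J`, while each block of its summand
  -- has a D subscript at least that index; no such block has the D part `J`.
  coefficient-stable : ∀ e → LocallyFinite e → ∀ d {n I J} → All (λ j → toℕ j ≤ n) J →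
                       coefficient e (d ℕ.+ n) (I , J) ≈ coefficient e n (I , J)
  coefficient-stable (block b) _ d J≤n = ≈-refl
  coefficient-stable (e ⊞ e′) (fin , fin′) d J≤n =
    +-cong (coefficient-stable e fin d J≤n) (coefficient-stable e′ fin′ d J≤n)
  coefficient-stable (a ⊡ e) fin d J≤n = *-congˡ (coefficient-stable e fin d J≤n)
  coefficient-stable (∑ e) fin d {n} {I} {J} J≤n = begin
    sum (λ i → coefficient (e i) (d ℕ.+ n) (I , J)) [1… d ℕ.+ n ]
      ≈⟨ sum-cong (λ i → coefficient-stable (e i) (proj₂ (fin i)) d J≤n) [1… d ℕ.+ n ] ⟩
    sum (λ i → coefficient (e i) n (I , J)) [1… d ℕ.+ n ]
      ≈⟨ sum-[1…] (λ i n<i → coefficient-dominated (e i) n (proj₁ (fin i))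
           (All.map (λ j≤n → ℕ.≤-<-trans j≤n n<i) J≤n)) d ⟩
    sum (λ i → coefficient (e i) n (I , J)) [1… n ]
      ∎

  -- For a locally finite e, truncating beyond the largest subscript of a D no longer changes
  -- the coefficient.
  limit : Expr → Block → Carrier
  limit e (I , J) = coefficient e (maximum J) (I , J)

  limit-cong : ∀ e {b b′} → b ≈ᴮ b′ → limit e b ≈ limit e b′
  limit-cong e {I , J} {I′ , J′} (I↭I′ , J↭J′) = begin
    coefficient e (maximum J) (I , J)      ≈⟨ coefficient-cong e (maximum J) (I↭I′ , J↭J′) ⟩
    coefficient e (maximum J) (I′ , J′)    ≡⟨ cong (λ n → coefficient e n (I′ , J′)) (maximum-↭ J↭J′) ⟩
    coefficient e (maximum J′) (I′ , J′)   ∎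

  -- The two coefficients can differ only if `J` has an entry above `bound f`, and then D_J
  -- annihilates `f`. This is why the equality holds only after multiplication by the action.
  limit-action : ∀ e → LocallyFinite e → ∀ f M b →
                 limit e b * action f M b ≈ coefficient e (bound f) b * action f M b
  limit-action e fin f M (I , J) with All.all? (λ j → toℕ j ℕ.≤? bound f) J
  ... | yes J≤f = *-congʳ (begin
    coefficient e (maximum J) (I , J)
      ≈⟨ coefficient-stable e fin (bound f ∸ maximum J) (≤-maximum J) ⟨
    coefficient e (bound f ∸ maximum J ℕ.+ maximum J) (I , J)
      ≡⟨ cong (λ n → coefficient e n (I , J)) (ℕ.m∸n+n≡m (maximum-≤ J≤f)) ⟩
    coefficient e (bound f) (I , J)
      ∎)
  ... | no J≰f = ≈-trans (vanish _) (≈-sym (vanish _))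
    where
    vanish : ∀ a → a * action f M (I , J) ≈ 0#
    vanish a = ≈-trans (*-congˡ (action-vanishes f M I J
      (Any.map ℕ.≰⇒> (All.¬All⇒Any¬ (λ j → toℕ j ℕ.≤? bound f) J J≰f)))) (zeroʳ a)

  limit-isExpansion : ∀ e → LocallyFinite e → IsExpansion ⟦ e ⟧ (limit e)
  limit-isExpansion e fin = record
    { respects = limit-cong e
    ; sums = λ f → record
      { support = S f
      ; unique  = S-unique f
      -- Off `S f` the coefficient `limit e b` itself may be nonzero. It is first exchanged, under
      -- the product with the action, for the truncated coefficient, which does vanish there.
      ; outside = λ b b∉S M → begin
          coeff (T f b) M
            ≈⟨ coeff-summand (limit e b) f M (proj₁ b) (proj₂ b) ⟩
          limit e b * action f M b
            ≈⟨ limit-action e fin f M b ⟩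
          coefficient e (bound f) b * action f M b
            ≈⟨ *-congʳ (coefficient-outside e (bound f) (All.¬Any⇒All¬ _ (b∉S ∘ ∈-S f))) ⟩
          0# * action f M b
            ≈⟨ zeroˡ _ ⟩
          0#
            ∎
      ; total   = λ M → begin
          coeff (concatMap (T f) (S f)) M
            ≈⟨ coeff-concatMap (T f) (S f) M ⟩
          sum (λ b → coeff (T f b) M) (S f)
            ≈⟨ sum-cong (λ (I , J) → coeff-summand (limit e (I , J)) f M I J) (S f) ⟩
          sum (λ b → limit e b * action f M b) (S f)
            ≈⟨ sum-cong (limit-action e fin f M) (S f) ⟩
          sum (λ b → coefficient e (bound f) b * action f M b) (S f)
            ≈⟨ ⟦⟧-expansion e f M (S-unique f) (All.tabulate λ b∈ b∉S →
                 b∉S (∈-S f (Any.map (λ { ≡.refl → ≈ᴮ.refl }) b∈))) ⟨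
          coeff (⟦ e ⟧ f) M
            ∎
      }
    }
    where
    T : Λ → Block → Λ
    T f (I , J) = (limit e (I , J) · p* I ∘ D* J) f
    S : Λ → List Block
    S f = deduplicate _≟ᴮ_ (blocks e (bound f))
    S-unique : ∀ f → Unique (S f)
    S-unique f = deduplicate-! Block-decSetoid (blocks e (bound f))
    ∈-S : ∀ f {b} → Any (b ≈ᴮ_) (blocks e (bound f)) → Any (b ≈ᴮ_) (S f)
    ∈-S f = Any.deduplicate⁺ _≟ᴮ_ (λ b″≈b′ b≈b′ → ≈ᴮ.trans b≈b′ (≈ᴮ.sym b″≈b′))

  -- Uniqueness of expansions

  module Uniqueness (ι-inverse : ∀ n → ∃ λ y → y * ι (suc n) ≈ 1#) where

    ι-cancel : ∀ n {x y} → x * ι (suc n) ≈ y * ι (suc n) → x ≈ y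
    ι-cancel n {x} {y} xn≈yn with ι-inverse n
    ... | r , rn≈1 = begin
      x                       ≈⟨ *-identityʳ x ⟨
      x * 1#                  ≈⟨ *-congˡ rn≈1 ⟨
      x * (r * ι (suc n))     ≈⟨ solve 3 (λ x r n → x :* (r :* n) := x :* n :* r) ≈-refl x r (ι (suc n)) ⟩
      x * ι (suc n) * r       ≈⟨ *-congʳ xn≈yn ⟩
      y * ι (suc n) * r       ≈⟨ solve 3 (λ y r n → y :* (r :* n) := y :* n :* r) ≈-refl y r (ι (suc n)) ⟨
      y * (r * ι (suc n))     ≈⟨ *-congˡ rn≈1 ⟩
      y * 1#                  ≈⟨ *-identityʳ y ⟩
      y                       ∎

    monomial : Multiset → Λ
    monomial J = (1# , J) ∷ []

    coeff-monomial-↭ : ∀ {J K} → J ↭ K → coeff (monomial J) K ≈ 1#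
    coeff-monomial-↭ {J} {K} J↭K =
      ≈-trans (coeff-∷ 1# J [] K) (≈-trans (+-identityʳ _) (restrict-yes (J ↭? K) 1# J↭K))

    coeff-monomial-↭̸ : ∀ {J K} → ¬ (J ↭ K) → coeff (monomial J) K ≈ 0#
    coeff-monomial-↭̸ {J} {K} J↭̸K =
      ≈-trans (coeff-∷ 1# J [] K) (≈-trans (+-identityʳ _) (restrict-no (J ↭? K) 1# J↭̸K))

    -- The number is D_J p_J, that is, the product of k^m · m! over the distinct entries k of `J`
    -- with multiplicity m. It is the pivot by which the coefficient of p_I D_J is recovered.
    action-diagonal : ∀ I J → ∃ λ n → action (monomial J) I (I , J) ≈ ι (suc n)
    action-diagonal I J with coeff-D* J []
    ... | n , eq = n , (begin
      coeff (p* I (D* J (monomial J))) I          ≈⟨ coeff-p*-++ I (D* J (monomial J)) (↭.++-identityʳ I) ⟩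
      coeff (D* J (monomial J)) []                ≈⟨ eq (monomial J) ⟩
      ι (suc n) * coeff (monomial J) (J ++ [])    ≈⟨ *-congˡ (coeff-monomial-↭ (↭-sym (↭.++-identityʳ J))) ⟩
      ι (suc n) * 1#                              ≈⟨ *-identityʳ _ ⟩
      ι (suc n)                                   ∎)

    -- A surviving term needs I = I′ ⊎ K and J = J′ ⊎ K with the same K. The length hypothesis
    -- forces K to be empty, and then the two blocks coincide.
    action-triangular : ∀ I J I′ J′ → length J ≤ length J′ → ¬ (I′ , J′) ≈ᴮ (I , J) →
                        action (monomial J) I (I′ , J′) ≈ 0#
    action-triangular I J I′ J′ ∣J∣≤∣J′∣ b′≉b with difference I′ I
    ... | no ∄K = coeff-p*-∄ I′ (D* J′ (monomial J)) ∄K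
    ... | yes (K , I′K↭I) with coeff-D* J′ K
    ...   | n , eq = begin
      coeff (p* I′ (D* J′ (monomial J))) I          ≈⟨ coeff-p*-++ I′ (D* J′ (monomial J)) I′K↭I ⟩
      coeff (D* J′ (monomial J)) K                  ≈⟨ eq (monomial J) ⟩
      ι (suc n) * coeff (monomial J) (J′ ++ K)      ≈⟨ *-congˡ (coeff-monomial-↭̸ (J↭̸J′K K I′K↭I)) ⟩
      ι (suc n) * 0#                                ≈⟨ zeroʳ _ ⟩
      0#                                            ∎
      where
      J↭̸J′K : ∀ K → I′ ++ K ↭ I → ¬ (J ↭ J′ ++ K)
      J↭̸J′K []      I′↭I J↭J′ = b′≉b
        (↭-trans (↭-sym (↭.++-identityʳ I′)) I′↭I , ↭-sym (↭-trans J↭J′ (↭.++-identityʳ J′)))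
      J↭̸J′K (k ∷ K) _ J↭J′kK with () ← ↭-++⇒[] J′ ∣J∣≤∣J′∣ J↭J′kK

    expansion-sum : ∀ {Δ c} (exp : IsExpansion Δ c) f M →
      ∃ λ S → Unique S × (∀ b → b ∉ᴮ S → c b * action f M b ≈ 0#) ×
              sum (λ b → c b * action f M b) S ≈ coeff (Δ f) M
    expansion-sum {Δ} {c} exp f M = support , unique ,
      (λ (I , J) b∉S → ≈-trans (≈-sym (coeff-summand (c (I , J)) f M I J)) (outside (I , J) b∉S M)) ,
      (begin
        sum (λ b → c b * action f M b) support
          ≈⟨ sum-cong (λ (I , J) → coeff-summand (c (I , J)) f M I J) support ⟨
        sum (λ (I , J) → coeff ((c (I , J) · p* I ∘ D* J) f) M) support
          ≈⟨ coeff-concatMap (λ (I , J) → (c (I , J) · p* I ∘ D* J) f) support M ⟨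
        coeff (concatMap (λ (I , J) → (c (I , J) · p* I ∘ D* J) f) support) M
          ≈⟨ total M ⟩
        coeff (Δ f) M
          ∎)
      where open HasSum (IsExpansion.sums exp f)

    sum-neg : ∀ (g : Block → Carrier) S → sum (λ b → - g b) S ≈ - sum g S
    sum-neg g []      = ≈-sym -0#≈0#
    sum-neg g (b ∷ S) = ≈-trans (+-congˡ (sum-neg g S)) (-‿+-comm (g b) (sum g S))

    -- n bounds the length of J, for the strong induction.
    expansion-unique : ∀ {Δ c c′} → IsExpansion Δ c → IsExpansion Δ c′ →
                       ∀ n I J → length J < n → c (I , J) ≈ c′ (I , J)
    expansion-unique {Δ} {c} {c′} exp exp′ (suc n) I J (ℕ.s≤s ∣J∣≤n)
      with action-diagonal I J
         | expansion-sum exp (monomial J) I | expansion-sum exp′ (monomial J) I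
    ... | m , φ≈m | S , S-unique , g≈0 , ∑g | S′ , S′-unique , g′≈0 , ∑g′ = ι-cancel m (begin
      c (I , J) * ι (suc m)       ≈⟨ *-congˡ φ≈m ⟨
      g (I , J)                   ≈⟨ x-y≈0⇒x≈y _ _ h≈0 ⟩
      g′ (I , J)                  ≈⟨ *-congˡ φ≈m ⟩
      c′ (I , J) * ι (suc m)      ∎)
      where
      φ g g′ h : Block → Carrier
      φ = action (monomial J) I
      g b = c b * φ b
      g′ b = c′ b * φ b
      -- Neither `g` nor `g′` is concentrated at (I , J), since blocks with a shorter D part may
      -- contribute. By induction these contributions agree, so they cancel in the difference.
      h b = g b - g′ b

      g-cong : ∀ {b b′} → b ≈ᴮ b′ → g b ≈ g b′
      g-cong b≈b′ = *-cong (IsExpansion.respects exp b≈b′) (action-cong (monomial J) I b≈b′)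

      g′-cong : ∀ {b b′} → b ≈ᴮ b′ → g′ b ≈ g′ b′
      g′-cong b≈b′ = *-cong (IsExpansion.respects exp′ b≈b′) (action-cong (monomial J) I b≈b′)

      h-cong : ∀ {b b′} → b ≈ᴮ b′ → h b ≈ h b′
      h-cong b≈b′ = +-cong (g-cong b≈b′) (-‿cong (g′-cong b≈b′))

      -- The two expansions come with different supports; the difference is summed over their union.
      U : List Block
      U = deduplicate _≟ᴮ_ (S ++ S′)

      U-unique : Unique U
      U-unique = deduplicate-! Block-decSetoid (S ++ S′)

      ∈-U : ∀ {b} → Any (b ≈ᴮ_) (S ++ S′) → Any (b ≈ᴮ_) U
      ∈-U = Any.deduplicate⁺ _≟ᴮ_ (λ b″≈b′ b≈b′ → ≈ᴮ.trans b≈b′ (≈ᴮ.sym b″≈b′))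

      g≈0-U : ∀ b → b ∉ᴮ U → g b ≈ 0#
      g≈0-U b b∉U = g≈0 b (b∉U ∘ ∈-U ∘ Any.++⁺ˡ)

      g′≈0-U : ∀ b → b ∉ᴮ U → g′ b ≈ 0#
      g′≈0-U b b∉U = g′≈0 b (b∉U ∘ ∈-U ∘ Any.++⁺ʳ S)

      h-outside : ∀ b → b ∉ᴮ (I , J) ∷ [] → h b ≈ 0#
      -- A shorter `J′` falls under the induction hypothesis. For every other block the action on
      -- p_J has no p_I term.
      h-outside (I′ , J′) b′∉ with length J′ ℕ.<? length J
      ... | yes ∣J′∣<∣J∣ = x≈y⇒x-y≈0
        (*-congʳ (expansion-unique exp exp′ n I′ J′ (ℕ.<-≤-trans ∣J′∣<∣J∣ ∣J∣≤n)))
      ... | no  ∣J′∣≮∣J∣ = x≈y⇒x-y≈0 (≈-trans (vanish c) (≈-sym (vanish c′)))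
        where
        vanish : ∀ (c : Block → Carrier) → c (I′ , J′) * φ (I′ , J′) ≈ 0#
        vanish c = ≈-trans
          (*-congˡ (action-triangular I J I′ J′ (ℕ.≮⇒≥ ∣J′∣≮∣J∣) (b′∉ ∘ here))) (zeroʳ _)

      h≈0 : h (I , J) ≈ 0#
      h≈0 = begin
        -- As `h` vanishes off the block (I , J), its value there is its whole sum. Over `U` that
        -- sum is the p_I-coefficient of the image of p_J, computed once from each expansion and
        -- subtracted from itself.
        h (I , J)
          ≈⟨ +-identityʳ _ ⟨
        sum h ((I , J) ∷ [])
          ≈⟨ sum-support ([] ∷ []) U-unique h-cong h-outside
               (λ b b∉U → x≈y⇒x-y≈0 (≈-trans (g≈0-U b b∉U) (≈-sym (g′≈0-U b b∉U)))) ⟩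
        sum h U
          ≈⟨ sum-+ g (λ b → - g′ b) U ⟩
        sum g U + sum (λ b → - g′ b) U
          ≈⟨ +-congˡ (sum-neg g′ U) ⟩
        sum g U - sum g′ U
          ≈⟨ x≈y⇒x-y≈0 (begin
               sum g U                      ≈⟨ sum-support S-unique U-unique g-cong g≈0 g≈0-U ⟨
               sum g S                      ≈⟨ ∑g ⟩
               coeff (Δ (monomial J)) I     ≈⟨ ∑g′ ⟨
               sum g′ S′                    ≈⟨ sum-support S′-unique U-unique g′-cong g′≈0 g′≈0-U ⟩
               sum g′ U                     ∎) ⟩
        0#
          ∎

  -- Coefficients in a subring

  record IsSubring (Z : Carrier → Set) : Set where
    field
      Z-resp : ∀ {x y} → x ≈ y → Z y → Z x
      Z-0    : Z 0#
      Z-1    : Z 1#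
      Z-−1   : Z (- 1#)
      Z-+    : ∀ {x y} → Z x → Z y → Z (x + y)
      Z-*    : ∀ {x y} → Z x → Z y → Z (x * y)

  module Integrality {Z : Carrier → Set} (isSubring : IsSubring Z) where
    open IsSubring isSubring

    Z-ι : ∀ n → Z (ι n)
    Z-ι zero    = Z-0
    Z-ι (suc n) = Z-+ Z-1 (Z-ι n)

    Z-sum : ∀ {A : Set} {g : A → Carrier} → (∀ x → Z (g x)) → ∀ xs → Z (sum g xs)
    Z-sum Z-g []       = Z-0
    Z-sum Z-g (x ∷ xs) = Z-+ (Z-g x) (Z-sum Z-g xs)

    -- Single off-diagonal terms may lie outside `Z`. Peeling off `x` leaves the corner `g x x` and
    -- the first row and first column, whose entries are joined in transposed pairs.
    Z-symmetric-sum : ∀ {A : Set} {g : A → A → Carrier} → (∀ i → Z (g i i)) →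
                      (∀ i j → Z (g i j + g j i)) → ∀ xs → Z (sum (λ i → sum (g i) xs) xs)
    Z-symmetric-sum         Z-diag Z-off []       = Z-0
    Z-symmetric-sum {g = g} Z-diag Z-off (x ∷ xs) = Z-resp (begin
      (g x x + sum (g x) xs) + sum (λ i → g i x + sum (g i) xs) xs
        ≈⟨ +-congˡ (sum-+ (λ i → g i x) (λ i → sum (g i) xs) xs) ⟩
      (g x x + sum (g x) xs) + (sum (λ i → g i x) xs + sum (λ i → sum (g i) xs) xs)
        ≈⟨ solve 4 (λ a b c d → (a :+ b) :+ (c :+ d) := (a :+ (b :+ c)) :+ d) ≈-refl
             (g x x) (sum (g x) xs) (sum (λ i → g i x) xs) (sum (λ i → sum (g i) xs) xs) ⟩
      (g x x + (sum (g x) xs + sum (λ i → g i x) xs)) + sum (λ i → sum (g i) xs) xs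
        ≈⟨ +-congʳ (+-congˡ (sum-+ (g x) (λ i → g i x) xs)) ⟨
      (g x x + sum (λ i → g x i + g i x) xs) + sum (λ i → sum (g i) xs) xs
        ∎)
      (Z-+ (Z-+ (Z-diag x) (Z-sum (Z-off x) xs)) (Z-symmetric-sum Z-diag Z-off xs))

    -- A termwise criterion, hence only sufficient: applied to all of `e₃` it would demand that
    -- `³⁄₂` lie in `Z`, although that denominator disappears only when blocks are collected.
    Integral : Expr → Set
    Integral (block b) = ⊤
    Integral (e ⊞ e′)  = Integral e × Integral e′
    Integral (a ⊡ e)   = Z a × Integral e
    Integral (∑ e)     = ∀ i → Integral (e i)

    Z-coefficient : ∀ e → Integral e → ∀ n b → Z (coefficient e n b)
    Z-coefficient (block b′) _            n b with does (b′ ≟ᴮ b)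
    ... | true  = Z-1
    ... | false = Z-0
    Z-coefficient (e ⊞ e′) (int , int′) n b = Z-+ (Z-coefficient e int n b) (Z-coefficient e′ int′ n b)
    Z-coefficient (a ⊡ e)  (Z-a , int)  n b = Z-* Z-a (Z-coefficient e int n b)
    Z-coefficient (∑ e)    int          n b = Z-sum (λ i → Z-coefficient (e i) (int i) n b) [1… n ]

  -- The Goulden-Jackson operators as expressions

  module GouldenJackson (α : Carrier) (³⁄₂ : Carrier) where

    -- With the variable of ℚ(α) for `α` and the constant 3/2 for `³⁄₂`, the operators `⟦ e₂ ⟧` and
    -- `⟦ e₃ ⟧` unfold to `Δ₂` and `Δ₃`. Here both are arbitrary ring elements; integrality will ask
    -- of `³⁄₂` only that its double lie in the subring.
    e₂ : Expr
    e₂ = α ⊡ (∑ λ i → ∑ λ j → block (i ∷ j ∷ [] , i +⁺ j ∷ []))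
       ⊞ (∑ λ i → ∑ λ j → block (i +⁺ j ∷ [] , i ∷ j ∷ []))
       ⊞ (α + - 1#) ⊡ (∑ λ k → ι (toℕ k ∸ 1) ⊡ block (k ∷ [] , k ∷ []))

    tripleTerms : ℕ⁺ → ℕ⁺ → ℕ⁺ → Expr
    tripleTerms i j k = block (i +⁺ j +⁺ k ∷ [] , i ∷ j ∷ k ∷ [])
              ⊞ α ⊡ block (i +⁺ k ∷ j ∷ [] , i +⁺ j ∷ k ∷ [])
              ⊞ α ⊡ block (i +⁺ j ∷ k ∷ [] , i ∷ j +⁺ k ∷ [])
              ⊞ block (i +⁺ j +⁺ k ∷ [] , i +⁺ j +⁺ k ∷ [])
              ⊞ (α * α) ⊡ block (i ∷ j ∷ k ∷ [] , i +⁺ j +⁺ k ∷ [])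
              ⊞ α ⊡ block (i ∷ j +⁺ k ∷ [] , i +⁺ k ∷ j ∷ [])

    pairTerms : ℕ⁺ → ℕ⁺ → Expr
    pairTerms i j = ι (toℕ i ℕ.+ toℕ j ∸ 2) ⊡
               ( α ⊡ block (i ∷ j ∷ [] , i +⁺ j ∷ [])
               ⊞ block (i +⁺ j ∷ [] , i ∷ j ∷ []))

    binomialTerms : Expr
    binomialTerms = ∑ λ k → ι ((toℕ k ∸ 1) C 2) ⊡ block (k ∷ [] , k ∷ [])

    e₃ : Expr
    e₃ = (∑ λ i → ∑ λ j → ∑ λ k → tripleTerms i j k)
       ⊞ (α + - 1#) ⊡ (³⁄₂ ⊡ (∑ λ i → ∑ λ j → pairTerms i j) ⊞ (ι 2 * α + - 1#) ⊡ binomialTerms)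

    ≤-+ˡ : ∀ i j → toℕ i ≤ toℕ (i +⁺ j)
    ≤-+ˡ i j = ℕ.m≤m+n (toℕ i) (toℕ j)

    ≤-+ʳ : ∀ i j → toℕ j ≤ toℕ (i +⁺ j)
    ≤-+ʳ i j = ℕ.m≤n+m (toℕ j) (toℕ i)

    e₂-locallyFinite : LocallyFinite e₂
    e₂-locallyFinite =
      ( (λ i → (λ j → here (≤-+ˡ i j)) , λ j → here (≤-+ʳ i j) , tt)
      , (λ i → (λ j → here ℕ.≤-refl) , λ j → there (here ℕ.≤-refl) , tt))
      , λ k → here ℕ.≤-refl , tt

    e₃-locallyFinite : LocallyFinite e₃
    e₃-locallyFinite =
        -- The three nested groups treat the indices i, j and k in turn. The six entries of each
        -- group follow the blocks of `tripleTerms` and pick a D subscript in which the index occurs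
        -- as a summand.
        (λ i →
            (λ j k → ((((here ℕ.≤-refl
                       , here (≤-+ˡ i j))
                       , here ℕ.≤-refl)
                       , here (i≤ i j k))
                       , here (i≤ i j k))
                       , here (≤-+ˡ i k))
          , λ j →
              (λ k → ((((there (here ℕ.≤-refl)
                       , here (≤-+ʳ i j))
                       , there (here (≤-+ˡ j k)))
                       , here (j≤ i j k))
                       , here (j≤ i j k))
                       , there (here ℕ.≤-refl))
            , λ k →
                (((((there (there (here ℕ.≤-refl))
                       , there (here ℕ.≤-refl))
                       , there (here (≤-+ʳ j k)))
                       , here (≤-+ʳ (i +⁺ j) k))
                       , here (≤-+ʳ (i +⁺ j) k))
                       , here (≤-+ʳ i k))
              , _)
      , (λ i →
            (λ j → here (≤-+ˡ i j) , here ℕ.≤-refl)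
          , λ j → (here (≤-+ʳ i j) , there (here ℕ.≤-refl)) , _)
      , λ k → here ℕ.≤-refl , tt
      where
      i≤ : ∀ i j k → toℕ i ≤ toℕ (i +⁺ j +⁺ k)
      i≤ i j k = ℕ.≤-trans (≤-+ˡ i j) (≤-+ˡ (i +⁺ j) k)
      j≤ : ∀ i j k → toℕ j ≤ toℕ (i +⁺ j +⁺ k)
      j≤ i j k = ℕ.≤-trans (≤-+ʳ i j) (≤-+ˡ (i +⁺ j) k)

    +⁺-comm : ∀ i j → i +⁺ j ≡ j +⁺ i
    +⁺-comm (1+ m) (1+ n) = cong (1+_ ∘ ℕ.pred) (ℕ.+-comm (suc m) (suc n))

    pairTerms-symmetric : ∀ i j n b → coefficient (pairTerms i j) n b ≈ coefficient (pairTerms j i) n b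
    pairTerms-symmetric i j n b = *-cong
      (reflexive (cong (λ m → ι (m ∸ 2)) (ℕ.+-comm (toℕ i) (toℕ j))))
      (+-cong (*-congˡ (block-≈ (↭.swap i j ↭-refl , ↭-reflexive (cong (_∷ []) (+⁺-comm i j)))))
              (block-≈ (↭-reflexive (cong (_∷ []) (+⁺-comm i j)) , ↭.swap i j ↭-refl)))
      where
      block-≈ : ∀ {b₁ b₂} → b₁ ≈ᴮ b₂ → coefficient (block b₁) n b ≈ coefficient (block b₂) n b
      block-≈ {b₁} {b₂} b₁≈b₂ = restrict-cong (b₁ ≟ᴮ b) (b₂ ≟ᴮ b)
        (≈ᴮ.trans (≈ᴮ.sym b₁≈b₂)) (≈ᴮ.trans b₁≈b₂) (λ _ → ≈-refl)

    ι-double : ∀ m → ι (suc m ℕ.+ suc m ∸ 2) ≈ ι m + ι m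
    ι-double m = ≈-trans (reflexive (cong (λ n → ι (n ∸ 1)) (ℕ.+-suc m m))) (×-homo-+ 1# m m)

    module _ {Z : Carrier → Set} (isSubring : IsSubring Z) (Z-α : Z α) (Z-3 : Z (³⁄₂ + ³⁄₂)) where
      open IsSubring isSubring
      open Integrality isSubring

      Z-limit-e₂ : ∀ b → Z (limit e₂ b)
      Z-limit-e₂ (I , J) = Z-coefficient e₂
        (((Z-α , _) , _) , Z-+ Z-α Z-−1 , λ k → Z-ι (toℕ k ∸ 1) , tt) (maximum J) (I , J)

      -- The factor is distributed over the double sum because it is absorbed differently: off the
      -- diagonal by the transposed term, on the diagonal by the even scalar of the term itself.
      Z-³⁄₂-pairTerms : ∀ n b → Z (coefficient (³⁄₂ ⊡ ∑ λ i → ∑ λ j → pairTerms i j) n b)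
      Z-³⁄₂-pairTerms n b = Z-resp (begin
        ³⁄₂ * sum (λ i → sum (c i) [1… n ]) [1… n ]
          ≈⟨ sum-*ˡ ³⁄₂ (λ i → sum (c i) [1… n ]) [1… n ] ⟨
        sum (λ i → ³⁄₂ * sum (c i) [1… n ]) [1… n ]
          ≈⟨ sum-cong (λ i → sum-*ˡ ³⁄₂ (c i) [1… n ]) [1… n ] ⟨
        sum (λ i → sum (λ j → ³⁄₂ * c i j) [1… n ]) [1… n ]
          ∎)
        (Z-symmetric-sum diagonal off-diagonal [1… n ])
        where
        c : ℕ⁺ → ℕ⁺ → Carrier
        c i j = coefficient (pairTerms i j) n b

        pairBlocks : ℕ⁺ → ℕ⁺ → Expr
        pairBlocks i j = α ⊡ block (i ∷ j ∷ [] , i +⁺ j ∷ []) ⊞ block (i +⁺ j ∷ [] , i ∷ j ∷ [])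

        Z-pairBlocks : ∀ i j → Z (coefficient (pairBlocks i j) n b)
        Z-pairBlocks i j = Z-coefficient (pairBlocks i j) ((Z-α , tt) , tt) n b

        diagonal : ∀ i → Z (³⁄₂ * c i i)
        diagonal i@(1+ m) = Z-resp (begin
          ³⁄₂ * (ι (suc m ℕ.+ suc m ∸ 2) * y)   ≈⟨ *-congˡ (*-congʳ (ι-double m)) ⟩
          -- The doubling is moved from the scalar to `³⁄₂`, whose double is in `Z`.
          ³⁄₂ * ((ι m + ι m) * y)               ≈⟨ solve 3 (λ h x y →
            h :* ((x :+ x) :* y) := (h :+ h) :* (x :* y)) ≈-refl ³⁄₂ (ι m) y ⟩
          (³⁄₂ + ³⁄₂) * (ι m * y)               ∎)
          (Z-* Z-3 (Z-* (Z-ι m) (Z-pairBlocks i i)))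
          where y = coefficient (pairBlocks i i) n b

        off-diagonal : ∀ i j → Z (³⁄₂ * c i j + ³⁄₂ * c j i)
        off-diagonal i j = Z-resp (begin
          ³⁄₂ * c i j + ³⁄₂ * c j i   ≈⟨ +-congˡ (*-congˡ (pairTerms-symmetric i j n b)) ⟨
          ³⁄₂ * c i j + ³⁄₂ * c i j   ≈⟨ distribʳ (c i j) ³⁄₂ ³⁄₂ ⟨
          (³⁄₂ + ³⁄₂) * c i j         ∎)
          (Z-* Z-3 (Z-* (Z-ι (toℕ i ℕ.+ toℕ j ∸ 2)) (Z-pairBlocks i j)))

      Z-limit-e₃ : ∀ b → Z (limit e₃ b)
      Z-limit-e₃ (I , J) = Z-+
        (Z-coefficient (∑ λ i → ∑ λ j → ∑ λ k → tripleTerms i j k)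
          (λ i j k → ((((tt , Z-α , tt) , Z-α , tt) , tt) , Z-* Z-α Z-α , tt) , Z-α , tt) n (I , J))
        (Z-* (Z-+ Z-α Z-−1)
          (Z-+ (Z-³⁄₂-pairTerms n (I , J))
               (Z-* (Z-+ (Z-* (Z-ι 2) Z-α) Z-−1)
                    (Z-coefficient binomialTerms (λ k → Z-ι ((toℕ k ∸ 1) C 2) , tt) n (I , J)))))
        where n = maximum J

-- The field ℚ(α) and its subring ℤ[α]

module _ where
  open ≡.≡-Reasoning
  private module ℚ-Solver = Solver (CommutativeRing.commutativeSemiring ℚ.+-*-commutativeRing)

  scale : ℚ → Poly → Poly
  scale x = map (x ℚ.*_)

  coeff-+ : ∀ a b n → coeffₚ (a +ₚ b) n ≡ coeffₚ a n ℚ.+ coeffₚ b n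
  coeff-+ []      b       n       = ≡.sym (ℚ.+-identityˡ _)
  coeff-+ (x ∷ a) []      n       = ≡.sym (ℚ.+-identityʳ _)
  coeff-+ (x ∷ a) (y ∷ b) zero    = ≡.refl
  coeff-+ (x ∷ a) (y ∷ b) (suc n) = coeff-+ a b n

  coeff-neg : ∀ a n → coeffₚ (-ₚ a) n ≡ ℚ.- coeffₚ a n
  coeff-neg []      n       = ≡.refl
  coeff-neg (x ∷ a) zero    = ≡.refl
  coeff-neg (x ∷ a) (suc n) = coeff-neg a n

  coeff-scale : ∀ x b n → coeffₚ (scale x b) n ≡ x ℚ.* coeffₚ b n
  coeff-scale x []      n       = ≡.sym (ℚ.*-zeroʳ x)
  coeff-scale x (y ∷ b) zero    = ≡.refl
  coeff-scale x (y ∷ b) (suc n) = coeff-scale x b n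

  coeff-∷-* : ∀ x a b n →
              coeffₚ ((x ∷ a) *ₚ b) n ≡ x ℚ.* coeffₚ b n ℚ.+ coeffₚ (0ℚ ∷ a *ₚ b) n
  coeff-∷-* x a b n = ≡.trans (coeff-+ (scale x b) _ n)
                              (cong (ℚ._+ coeffₚ (0ℚ ∷ a *ₚ b) n) (coeff-scale x b n))

  ∷-cong : ∀ {x y a b} → x ≡ y → a ≈ₚ b → x ∷ a ≈ₚ y ∷ b
  ∷-cong x≡y a≈b zero    = x≡y
  ∷-cong x≡y a≈b (suc n) = a≈b n

  +ₚ-cong : ∀ a a′ b b′ → a ≈ₚ a′ → b ≈ₚ b′ → a +ₚ b ≈ₚ a′ +ₚ b′
  +ₚ-cong a a′ b b′ a≈a′ b≈b′ n = begin
    coeffₚ (a +ₚ b) n             ≡⟨ coeff-+ a b n ⟩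
    coeffₚ a n ℚ.+ coeffₚ b n     ≡⟨ cong₂ ℚ._+_ (a≈a′ n) (b≈b′ n) ⟩
    coeffₚ a′ n ℚ.+ coeffₚ b′ n   ≡⟨ coeff-+ a′ b′ n ⟨
    coeffₚ (a′ +ₚ b′) n           ∎

  +ₚ-assoc : ∀ a b c → (a +ₚ b) +ₚ c ≈ₚ a +ₚ (b +ₚ c)
  +ₚ-assoc a b c n = begin
    coeffₚ (a +ₚ b +ₚ c) n                      ≡⟨ coeff-+ (a +ₚ b) c n ⟩
    coeffₚ (a +ₚ b) n ℚ.+ coeffₚ c n            ≡⟨ cong (ℚ._+ _) (coeff-+ a b n) ⟩
    coeffₚ a n ℚ.+ coeffₚ b n ℚ.+ coeffₚ c n    ≡⟨ ℚ.+-assoc (coeffₚ a n) _ _ ⟩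
    coeffₚ a n ℚ.+ (coeffₚ b n ℚ.+ coeffₚ c n)  ≡⟨ cong (coeffₚ a n ℚ.+_) (coeff-+ b c n) ⟨
    coeffₚ a n ℚ.+ coeffₚ (b +ₚ c) n            ≡⟨ coeff-+ a (b +ₚ c) n ⟨
    coeffₚ (a +ₚ (b +ₚ c)) n                    ∎

  +ₚ-comm : ∀ a b → a +ₚ b ≈ₚ b +ₚ a
  +ₚ-comm a b n = begin
    coeffₚ (a +ₚ b) n          ≡⟨ coeff-+ a b n ⟩
    coeffₚ a n ℚ.+ coeffₚ b n  ≡⟨ ℚ.+-comm (coeffₚ a n) _ ⟩
    coeffₚ b n ℚ.+ coeffₚ a n  ≡⟨ coeff-+ b a n ⟨
    coeffₚ (b +ₚ a) n          ∎

  -ₚ-inverseˡ : ∀ a → (-ₚ a) +ₚ a ≈ₚ []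
  -ₚ-inverseˡ a n = begin
    coeffₚ ((-ₚ a) +ₚ a) n            ≡⟨ coeff-+ (-ₚ a) a n ⟩
    coeffₚ (-ₚ a) n ℚ.+ coeffₚ a n    ≡⟨ cong (ℚ._+ coeffₚ a n) (coeff-neg a n) ⟩
    ℚ.- coeffₚ a n ℚ.+ coeffₚ a n     ≡⟨ ℚ.+-inverseˡ (coeffₚ a n) ⟩
    0ℚ                                ∎

  -ₚ-cong : ∀ {a b} → a ≈ₚ b → -ₚ a ≈ₚ -ₚ b
  -ₚ-cong {a} {b} a≈b n = begin
    coeffₚ (-ₚ a) n   ≡⟨ coeff-neg a n ⟩
    ℚ.- coeffₚ a n    ≡⟨ cong ℚ.-_ (a≈b n) ⟩
    ℚ.- coeffₚ b n    ≡⟨ coeff-neg b n ⟨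
    coeffₚ (-ₚ b) n   ∎

  *ₚ-congˡ : ∀ a {b b′} → b ≈ₚ b′ → a *ₚ b ≈ₚ a *ₚ b′
  *ₚ-congˡ []      b≈b′ n = ≡.refl
  *ₚ-congˡ (x ∷ a) {b} {b′} b≈b′ n = begin
    coeffₚ ((x ∷ a) *ₚ b) n                        ≡⟨ coeff-∷-* x a b n ⟩
    x ℚ.* coeffₚ b n ℚ.+ coeffₚ (0ℚ ∷ a *ₚ b) n    ≡⟨ cong₂ ℚ._+_ (cong (x ℚ.*_) (b≈b′ n))
                                                       (∷-cong {a = a *ₚ b} ≡.refl (*ₚ-congˡ a b≈b′) n) ⟩
    x ℚ.* coeffₚ b′ n ℚ.+ coeffₚ (0ℚ ∷ a *ₚ b′) n  ≡⟨ coeff-∷-* x a b′ n ⟨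
    coeffₚ ((x ∷ a) *ₚ b′) n                       ∎

  *ₚ-zeroʳ : ∀ a → a *ₚ [] ≈ₚ []
  *ₚ-zeroʳ []      n       = ≡.refl
  *ₚ-zeroʳ (x ∷ a) zero    = ≡.refl
  *ₚ-zeroʳ (x ∷ a) (suc n) = *ₚ-zeroʳ a n

  -- Multiplication is defined by recursion on the first factor; this is the matching recursion in
  -- the second, from which commutativity follows by induction.
  *ₚ-∷ : ∀ a y b → a *ₚ (y ∷ b) ≈ₚ scale y a +ₚ (0ℚ ∷ a *ₚ b)
  *ₚ-∷ []      y b zero    = ≡.refl
  *ₚ-∷ []      y b (suc n) = ≡.refl
  *ₚ-∷ (x ∷ a) y b zero    = cong (ℚ._+ 0ℚ) (ℚ.*-comm x y)
  *ₚ-∷ (x ∷ a) y b (suc n) = begin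
    coeffₚ (scale x b +ₚ a *ₚ (y ∷ b)) n
      ≡⟨ coeff-+ (scale x b) _ n ⟩
    coeffₚ (scale x b) n ℚ.+ coeffₚ (a *ₚ (y ∷ b)) n
      ≡⟨ cong₂ ℚ._+_ (coeff-scale x b n) (*ₚ-∷ a y b n) ⟩
    x ℚ.* coeffₚ b n ℚ.+ coeffₚ (scale y a +ₚ (0ℚ ∷ a *ₚ b)) n
      ≡⟨ cong (x ℚ.* coeffₚ b n ℚ.+_) (coeff-+ (scale y a) (0ℚ ∷ a *ₚ b) n) ⟩
    x ℚ.* coeffₚ b n ℚ.+ (coeffₚ (scale y a) n ℚ.+ coeffₚ (0ℚ ∷ a *ₚ b) n)
      ≡⟨ ℚ-Solver.solve 3 (λ u v w → let open ℚ-Solver in u :+ (v :+ w) := v :+ (u :+ w)) ≡.refl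
           (x ℚ.* coeffₚ b n) (coeffₚ (scale y a) n) (coeffₚ (0ℚ ∷ a *ₚ b) n) ⟩
    coeffₚ (scale y a) n ℚ.+ (x ℚ.* coeffₚ b n ℚ.+ coeffₚ (0ℚ ∷ a *ₚ b) n)
      ≡⟨ cong (coeffₚ (scale y a) n ℚ.+_) (coeff-∷-* x a b n) ⟨
    coeffₚ (scale y a) n ℚ.+ coeffₚ ((x ∷ a) *ₚ b) n
      ≡⟨ coeff-+ (scale y a) _ n ⟨
    coeffₚ (scale y a +ₚ (x ∷ a) *ₚ b) n
      ∎

  *ₚ-comm : ∀ a b → a *ₚ b ≈ₚ b *ₚ a
  *ₚ-comm []      b n = ≡.sym (*ₚ-zeroʳ b n)
  *ₚ-comm (x ∷ a) b n = ≡.trans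
    (+ₚ-cong (scale x b) (scale x b) (0ℚ ∷ a *ₚ b) (0ℚ ∷ b *ₚ a)
      (λ _ → ≡.refl) (∷-cong {a = a *ₚ b} {b *ₚ a} ≡.refl (*ₚ-comm a b)) n)
    (≡.sym (*ₚ-∷ b x a n))

  -- Equal polynomials may have lists of different lengths, which makes a simultaneous recursion on
  -- `a` and `a′` awkward. Commutativity moves the change to the second factor.
  *ₚ-congʳ : ∀ {a a′} b → a ≈ₚ a′ → a *ₚ b ≈ₚ a′ *ₚ b
  *ₚ-congʳ {a} {a′} b a≈a′ n =
    ≡.trans (*ₚ-comm a b n) (≡.trans (*ₚ-congˡ b a≈a′ n) (*ₚ-comm b a′ n))

  *ₚ-distribˡ : ∀ a b c → a *ₚ (b +ₚ c) ≈ₚ a *ₚ b +ₚ a *ₚ c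
  *ₚ-distribˡ []      b c n = ≡.refl
  *ₚ-distribˡ (x ∷ a) b c n = begin
    coeffₚ ((x ∷ a) *ₚ (b +ₚ c)) n
      ≡⟨ coeff-∷-* x a (b +ₚ c) n ⟩
    x ℚ.* coeffₚ (b +ₚ c) n ℚ.+ coeffₚ (0ℚ ∷ a *ₚ (b +ₚ c)) n
      ≡⟨ cong₂ (λ u v → x ℚ.* u ℚ.+ v) (coeff-+ b c n) (shifted n) ⟩
    x ℚ.* (coeffₚ b n ℚ.+ coeffₚ c n) ℚ.+ (coeffₚ (0ℚ ∷ a *ₚ b) n ℚ.+ coeffₚ (0ℚ ∷ a *ₚ c) n)
      ≡⟨ ℚ-Solver.solve 5 (λ x u v w z → let open ℚ-Solver in
           x :* (u :+ v) :+ (w :+ z) := (x :* u :+ w) :+ (x :* v :+ z)) ≡.refl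
           x (coeffₚ b n) (coeffₚ c n) (coeffₚ (0ℚ ∷ a *ₚ b) n) (coeffₚ (0ℚ ∷ a *ₚ c) n) ⟩
    (x ℚ.* coeffₚ b n ℚ.+ coeffₚ (0ℚ ∷ a *ₚ b) n) ℚ.+ (x ℚ.* coeffₚ c n ℚ.+ coeffₚ (0ℚ ∷ a *ₚ c) n)
      ≡⟨ cong₂ ℚ._+_ (coeff-∷-* x a b n) (coeff-∷-* x a c n) ⟨
    coeffₚ ((x ∷ a) *ₚ b) n ℚ.+ coeffₚ ((x ∷ a) *ₚ c) n
      ≡⟨ coeff-+ ((x ∷ a) *ₚ b) _ n ⟨
    coeffₚ ((x ∷ a) *ₚ b +ₚ (x ∷ a) *ₚ c) n
      ∎
    where
    shifted : ∀ n → coeffₚ (0ℚ ∷ a *ₚ (b +ₚ c)) n ≡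
                    coeffₚ (0ℚ ∷ a *ₚ b) n ℚ.+ coeffₚ (0ℚ ∷ a *ₚ c) n
    shifted zero    = ≡.refl
    shifted (suc n) = ≡.trans (*ₚ-distribˡ a b c n) (coeff-+ (a *ₚ b) (a *ₚ c) n)

  *ₚ-distribʳ : ∀ a b c → (b +ₚ c) *ₚ a ≈ₚ b *ₚ a +ₚ c *ₚ a
  *ₚ-distribʳ a b c n = begin
    coeffₚ ((b +ₚ c) *ₚ a) n      ≡⟨ *ₚ-comm (b +ₚ c) a n ⟩
    coeffₚ (a *ₚ (b +ₚ c)) n      ≡⟨ *ₚ-distribˡ a b c n ⟩
    coeffₚ (a *ₚ b +ₚ a *ₚ c) n   ≡⟨ +ₚ-cong (a *ₚ b) (b *ₚ a) (a *ₚ c) (c *ₚ a) (*ₚ-comm a b) (*ₚ-comm a c) n ⟩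
    coeffₚ (b *ₚ a +ₚ c *ₚ a) n   ∎

  scale-* : ∀ x a b → scale x a *ₚ b ≈ₚ scale x (a *ₚ b)
  scale-* x []      b n = ≡.refl
  scale-* x (y ∷ a) b n = begin
    coeffₚ ((x ℚ.* y ∷ scale x a) *ₚ b) n
      ≡⟨ coeff-∷-* (x ℚ.* y) (scale x a) b n ⟩
    x ℚ.* y ℚ.* coeffₚ b n ℚ.+ coeffₚ (0ℚ ∷ scale x a *ₚ b) n
      ≡⟨ cong₂ ℚ._+_ (ℚ.*-assoc x y _) (shifted n) ⟩
    x ℚ.* (y ℚ.* coeffₚ b n) ℚ.+ x ℚ.* coeffₚ (0ℚ ∷ a *ₚ b) n
      ≡⟨ ℚ.*-distribˡ-+ x (y ℚ.* coeffₚ b n) _ ⟨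
    x ℚ.* (y ℚ.* coeffₚ b n ℚ.+ coeffₚ (0ℚ ∷ a *ₚ b) n)
      ≡⟨ cong (x ℚ.*_) (coeff-∷-* y a b n) ⟨
    x ℚ.* coeffₚ ((y ∷ a) *ₚ b) n
      ≡⟨ coeff-scale x ((y ∷ a) *ₚ b) n ⟨
    coeffₚ (scale x ((y ∷ a) *ₚ b)) n
      ∎
    where
    shifted : ∀ n → coeffₚ (0ℚ ∷ scale x a *ₚ b) n ≡ x ℚ.* coeffₚ (0ℚ ∷ a *ₚ b) n
    shifted zero    = ≡.sym (ℚ.*-zeroʳ x)
    shifted (suc n) = ≡.trans (scale-* x a b n) (coeff-scale x (a *ₚ b) n)

  0∷-* : ∀ a b → (0ℚ ∷ a) *ₚ b ≈ₚ 0ℚ ∷ (a *ₚ b)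
  0∷-* a b n = begin
    coeffₚ ((0ℚ ∷ a) *ₚ b) n                        ≡⟨ coeff-∷-* 0ℚ a b n ⟩
    0ℚ ℚ.* coeffₚ b n ℚ.+ coeffₚ (0ℚ ∷ a *ₚ b) n    ≡⟨ cong (ℚ._+ coeffₚ (0ℚ ∷ a *ₚ b) n)
                                                            (ℚ.*-zeroˡ (coeffₚ b n)) ⟩
    0ℚ ℚ.+ coeffₚ (0ℚ ∷ a *ₚ b) n                   ≡⟨ ℚ.+-identityˡ _ ⟩
    coeffₚ (0ℚ ∷ a *ₚ b) n                          ∎

  *ₚ-assoc : ∀ a b c → (a *ₚ b) *ₚ c ≈ₚ a *ₚ (b *ₚ c)
  *ₚ-assoc []      b c n = ≡.refl
  *ₚ-assoc (x ∷ a) b c n = begin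
    coeffₚ ((scale x b +ₚ (0ℚ ∷ a *ₚ b)) *ₚ c) n
      ≡⟨ *ₚ-distribʳ c (scale x b) (0ℚ ∷ a *ₚ b) n ⟩
    coeffₚ (scale x b *ₚ c +ₚ (0ℚ ∷ a *ₚ b) *ₚ c) n
      ≡⟨ +ₚ-cong (scale x b *ₚ c) (scale x (b *ₚ c)) ((0ℚ ∷ a *ₚ b) *ₚ c) (0ℚ ∷ a *ₚ (b *ₚ c))
           (scale-* x b c)
           (λ m → ≡.trans (0∷-* (a *ₚ b) c m)
             (∷-cong {a = a *ₚ b *ₚ c} {a *ₚ (b *ₚ c)} ≡.refl (*ₚ-assoc a b c) m)) n ⟩
    coeffₚ (scale x (b *ₚ c) +ₚ (0ℚ ∷ a *ₚ (b *ₚ c))) n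
      ∎

  *ₚ-identityˡ : ∀ a → (1ℚ ∷ []) *ₚ a ≈ₚ a
  *ₚ-identityˡ a n = begin
    coeffₚ ((1ℚ ∷ []) *ₚ a) n                         ≡⟨ coeff-∷-* 1ℚ [] a n ⟩
    1ℚ ℚ.* coeffₚ a n ℚ.+ coeffₚ (0ℚ ∷ []) n          ≡⟨ cong₂ ℚ._+_ (ℚ.*-identityˡ (coeffₚ a n)) (zeros n) ⟩
    coeffₚ a n ℚ.+ 0ℚ                                 ≡⟨ ℚ.+-identityʳ _ ⟩
    coeffₚ a n                                        ∎
    where
    zeros : ∀ n → coeffₚ (0ℚ ∷ []) n ≡ 0ℚ
    zeros zero    = ≡.refl
    zeros (suc n) = ≡.refl

  ≈ₚ-isEquivalence : IsEquivalence _≈ₚ_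
  ≈ₚ-isEquivalence = record
    { refl  = λ _ → ≡.refl
    ; sym   = λ a≈b n → ≡.sym (a≈b n)
    ; trans = λ a≈b b≈c n → ≡.trans (a≈b n) (b≈c n)
    }

ℚ[α] : CommutativeRing 0ℓ 0ℓ
ℚ[α] = record
  { Carrier = Poly
  ; _≈_ = _≈ₚ_
  ; _+_ = _+ₚ_
  ; _*_ = _*ₚ_
  ; -_ = -ₚ_
  ; 0# = []
  ; 1# = 1ℚ ∷ []
  ; isCommutativeRing = record
    { isRing = record
      { +-isAbelianGroup = record
        { isGroup = record
          { isMonoid = record
            { isSemigroup = record
              { isMagma = record
                { isEquivalence = ≈ₚ-isEquivalence
                ; ∙-cong = λ {a} {a′} {b} {b′} → +ₚ-cong a a′ b b′
                }
              ; assoc = +ₚ-assoc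
              }
            ; identity = (λ _ _ → ≡.refl) , λ a → +ₚ-comm a []
            }
          ; inverse = -ₚ-inverseˡ , λ a n → ≡.trans (+ₚ-comm a (-ₚ a) n) (-ₚ-inverseˡ a n)
          ; ⁻¹-cong = λ {a} {b} → -ₚ-cong {a} {b}
          }
        ; comm = +ₚ-comm
        }
      ; *-cong = λ {a} {a′} {b} {b′} a≈a′ b≈b′ n →
                   ≡.trans (*ₚ-congʳ {a} {a′} b a≈a′ n) (*ₚ-congˡ a′ {b} {b′} b≈b′ n)
      ; *-assoc = *ₚ-assoc
      ; *-identity = *ₚ-identityˡ , λ a n → ≡.trans (*ₚ-comm a (1ℚ ∷ []) n) (*ₚ-identityˡ a n)
      ; distrib = *ₚ-distribˡ , *ₚ-distribʳ
      }
    ; *-comm = *ₚ-comm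
    }
  }

module ℚ[α] = CommutativeRing ℚ[α]

Nonzeroₚ⇒≉0 : ∀ a → Nonzeroₚ a → ¬ a ≈ₚ []
Nonzeroₚ⇒≉0 (x ∷ a) (here x≢0)  a≈0 = x≢0 (a≈0 zero)
Nonzeroₚ⇒≉0 (x ∷ a) (there a≢0) a≈0 = Nonzeroₚ⇒≉0 a a≢0 (a≈0 ∘ suc)

¬Nonzeroₚ⇒≈0 : ∀ a → ¬ Nonzeroₚ a → a ≈ₚ []
¬Nonzeroₚ⇒≈0 []      _  n       = ≡.refl
¬Nonzeroₚ⇒≈0 (x ∷ a) a≡0 zero    with x ℚ.≟ 0ℚ
... | yes x≡0 = x≡0
... | no  x≢0 = contradiction (here x≢0) a≡0
¬Nonzeroₚ⇒≈0 (x ∷ a) a≡0 (suc n) = ¬Nonzeroₚ⇒≈0 a (a≡0 ∘ there) n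

-- It is decidable whether a - b has a nonzero coefficient. If it had one, its product with `d`
-- would be nonzero, because ℚ[α] has no zero divisors.
*ₚ-cancelʳ : ∀ a b d → Nonzeroₚ d → a *ₚ d ≈ₚ b *ₚ d → a ≈ₚ b
*ₚ-cancelʳ a b d d≢0 ad≈bd with any? (λ x → ¬? (x ℚ.≟ 0ℚ)) (a +ₚ (-ₚ b))
... | yes a-b≢0 = contradiction [a-b]d≈0 (Nonzeroₚ⇒≉0 _ (*ₚ-nonzero a-b≢0 d≢0))
  where
  open SetoidReasoning ℚ[α].setoid
  [a-b]d≈0 : (a +ₚ (-ₚ b)) *ₚ d ≈ₚ []
  [a-b]d≈0 = begin
    (a +ₚ (-ₚ b)) *ₚ d         ≈⟨ ℚ[α].distribʳ d a (-ₚ b) ⟩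
    a *ₚ d +ₚ (-ₚ b) *ₚ d      ≈⟨ ℚ[α].+-congʳ {(-ₚ b) *ₚ d} {a *ₚ d} {b *ₚ d} ad≈bd ⟩
    b *ₚ d +ₚ (-ₚ b) *ₚ d      ≈⟨ ℚ[α].distribʳ d b (-ₚ b) ⟨
    (b +ₚ (-ₚ b)) *ₚ d         ≈⟨ ℚ[α].*-congʳ {d} {b +ₚ (-ₚ b)} {[]} (ℚ[α].-‿inverseʳ b) ⟩
    [] *ₚ d                    ∎
... | no  a-b≡0 = begin
    a                          ≈⟨ ℚ[α].+-identityʳ a ⟨
    a +ₚ []                    ≈⟨ ℚ[α].+-congˡ {a} {(-ₚ b) +ₚ b} {[]} (ℚ[α].-‿inverseˡ b) ⟨
    a +ₚ ((-ₚ b) +ₚ b)         ≈⟨ ℚ[α].+-assoc a (-ₚ b) b ⟨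
    (a +ₚ (-ₚ b)) +ₚ b         ≈⟨ ℚ[α].+-congʳ {b} {a +ₚ (-ₚ b)} {[]} (¬Nonzeroₚ⇒≈0 _ a-b≡0) ⟩
    b                          ∎
  where open SetoidReasoning ℚ[α].setoid

-- Laws of fractions as identities between numerators and denominators

module Fractions {c ℓ} (R : CommutativeRing c ℓ) where
  open CommutativeRing R
  open SetoidReasoning setoid
  open Solver commutativeSemiring using (solve; _:+_; _:*_; _:=_)
  open import Algebra.Properties.Ring ring using (-‿distribˡ-*)

  -- Cross-multiplication yields transitivity only up to the middle denominator `d`. Removing it
  -- takes cancellation, which is specific to ℚ[α], whereas the identities here hold in every
  -- commutative ring.
  /-trans : ∀ a b c d e f → a * d ≈ c * b → c * f ≈ e * d → (a * f) * d ≈ (e * b) * d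
  /-trans a b c d e f ad≈cb cf≈ed = begin
    (a * f) * d   ≈⟨ solve 3 (λ a d f → (a :* f) :* d := (a :* d) :* f) refl a d f ⟩
    (a * d) * f   ≈⟨ *-congʳ ad≈cb ⟩
    (c * b) * f   ≈⟨ solve 3 (λ b c f → (c :* b) :* f := (c :* f) :* b) refl b c f ⟩
    (c * f) * b   ≈⟨ *-congʳ cf≈ed ⟩
    (e * d) * b   ≈⟨ solve 3 (λ b d e → (e :* d) :* b := (e :* b) :* d) refl b d e ⟩
    (e * b) * d   ∎

  /-+-cong : ∀ a b a′ b′ c d c′ d′ → a * b′ ≈ a′ * b → c * d′ ≈ c′ * d →
             (a * d + c * b) * (b′ * d′) ≈ (a′ * d′ + c′ * b′) * (b * d)
  /-+-cong a b a′ b′ c d c′ d′ ab′≈a′b cd′≈c′d = begin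
    (a * d + c * b) * (b′ * d′)
      ≈⟨ solve 6 (λ a b b′ c d d′ →
           (a :* d :+ c :* b) :* (b′ :* d′) := (a :* b′) :* (d :* d′) :+ (c :* d′) :* (b :* b′))
           refl a b b′ c d d′ ⟩
    (a * b′) * (d * d′) + (c * d′) * (b * b′)
      ≈⟨ +-cong (*-congʳ ab′≈a′b) (*-congʳ cd′≈c′d) ⟩
    (a′ * b) * (d * d′) + (c′ * d) * (b * b′)
      ≈⟨ solve 6 (λ a′ b b′ c′ d d′ →
           (a′ :* b) :* (d :* d′) :+ (c′ :* d) :* (b :* b′) := (a′ :* d′ :+ c′ :* b′) :* (b :* d))
           refl a′ b b′ c′ d d′ ⟩
    (a′ * d′ + c′ * b′) * (b * d)
      ∎

  /-*-cong : ∀ a b a′ b′ c d c′ d′ → a * b′ ≈ a′ * b → c * d′ ≈ c′ * d →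
             (a * c) * (b′ * d′) ≈ (a′ * c′) * (b * d)
  /-*-cong a b a′ b′ c d c′ d′ ab′≈a′b cd′≈c′d = begin
    (a * c) * (b′ * d′)   ≈⟨ interchange a c b′ d′ ⟩
    (a * b′) * (c * d′)   ≈⟨ *-cong ab′≈a′b cd′≈c′d ⟩
    (a′ * b) * (c′ * d)   ≈⟨ interchange a′ b c′ d ⟩
    (a′ * c′) * (b * d)   ∎
    where
    interchange = solve 4 (λ x y z w → (x :* y) :* (z :* w) := (x :* z) :* (y :* w)) refl

  /-neg-cong : ∀ a b a′ b′ → a * b′ ≈ a′ * b → (- a) * b′ ≈ (- a′) * b
  /-neg-cong a b a′ b′ ab′≈a′b = begin
    (- a) * b′    ≈⟨ -‿distribˡ-* a b′ ⟨
    - (a * b′)    ≈⟨ -‿cong ab′≈a′b ⟩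
    - (a′ * b)    ≈⟨ -‿distribˡ-* a′ b ⟩
    (- a′) * b    ∎

  /-+-assoc : ∀ a b c d e f →
              ((a * d + c * b) * f + e * (b * d)) * (b * (d * f)) ≈
              (a * (d * f) + (c * f + e * d) * b) * ((b * d) * f)
  /-+-assoc = solve 6 (λ a b c d e f →
    ((a :* d :+ c :* b) :* f :+ e :* (b :* d)) :* (b :* (d :* f)) :=
    (a :* (d :* f) :+ (c :* f :+ e :* d) :* b) :* ((b :* d) :* f)) refl

  /-+-comm : ∀ a b c d → (a * d + c * b) * (d * b) ≈ (c * b + a * d) * (b * d)
  /-+-comm = solve 4 (λ a b c d →
    (a :* d :+ c :* b) :* (d :* b) := (c :* b :+ a :* d) :* (b :* d)) refl

  -- The zero fraction has numerator `0ℚ ∷ []`, which equals the zero polynomial `[]` only up to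
  -- trailing zeros. Hence a numerator `z` with `z ≈ 0#` in place of a literal zero.
  /-+-identityˡ : ∀ z a b → z ≈ 0# → (z * b + a * 1#) * b ≈ a * (1# * b)
  /-+-identityˡ z a b z≈0 = begin
    (z * b + a * 1#) * b     ≈⟨ *-congʳ (+-congʳ (*-congʳ z≈0)) ⟩
    (0# * b + a * 1#) * b    ≈⟨ *-congʳ (+-congʳ (zeroˡ b)) ⟩
    (0# + a * 1#) * b        ≈⟨ *-congʳ (+-identityˡ _) ⟩
    (a * 1#) * b             ≈⟨ *-assoc a 1# b ⟩
    a * (1# * b)             ∎

  /-inverseˡ : ∀ z a b → z ≈ 0# → ((- a) * b + a * b) * 1# ≈ z * (b * b)
  /-inverseˡ z a b z≈0 = begin
    ((- a) * b + a * b) * 1#  ≈⟨ *-identityʳ _ ⟩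
    (- a) * b + a * b         ≈⟨ distribʳ b (- a) a ⟨
    ((- a) + a) * b           ≈⟨ *-congʳ (-‿inverseˡ a) ⟩
    0# * b                    ≈⟨ zeroˡ b ⟩
    0#                        ≈⟨ zeroˡ (b * b) ⟨
    0# * (b * b)              ≈⟨ *-congʳ z≈0 ⟨
    z * (b * b)               ∎

  /-*-assoc : ∀ a b c d e f → ((a * c) * e) * (b * (d * f)) ≈ (a * (c * e)) * ((b * d) * f)
  /-*-assoc a b c d e f = *-cong (*-assoc a c e) (sym (*-assoc b d f))

  /1-+-homo : ∀ a b → (a * 1# + b * 1#) * 1# ≈ (a + b) * (1# * 1#)
  /1-+-homo a b = *-cong (+-cong (*-identityʳ a) (*-identityʳ b)) (sym (*-identityʳ 1#))

  /1-*-homo : ∀ a b → (a * b) * 1# ≈ (a * b) * (1# * 1#)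
  /1-*-homo a b = *-congˡ (sym (*-identityʳ 1#))

  /-*-comm : ∀ a b c d → (a * c) * (d * b) ≈ (c * a) * (b * d)
  /-*-comm a b c d = *-cong (*-comm a c) (*-comm d b)

  /-*-identityˡ : ∀ a b → (1# * a) * b ≈ a * (1# * b)
  /-*-identityˡ a b = *-cong (*-identityˡ a) (sym (*-identityˡ b))

  /-distribˡ : ∀ a b c d e f →
               (a * (c * f + e * d)) * ((b * d) * (b * f)) ≈
               ((a * c) * (b * f) + (a * e) * (b * d)) * (b * (d * f))
  /-distribˡ = solve 6 (λ a b c d e f →
    (a :* (c :* f :+ e :* d)) :* ((b :* d) :* (b :* f)) :=
    ((a :* c) :* (b :* f) :+ (a :* e) :* (b :* d)) :* (b :* (d :* f))) refl

module F = Fractions ℚ[α]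

0∷[]≈0 : 0ℚ ∷ [] ≈ₚ []
0∷[]≈0 zero    = ≡.refl
0∷[]≈0 (suc n) = ≡.refl

≈ᶠ-trans : ∀ {x y z} → x ≈ᶠ y → y ≈ᶠ z → x ≈ᶠ z
≈ᶠ-trans {a / b [ _ ]} {c / d [ d≢0 ]} {e / f [ _ ]} x≈y y≈z =
  *ₚ-cancelʳ (a *ₚ f) (e *ₚ b) d d≢0 (F./-trans a b c d e f x≈y y≈z)

+ᶠ-comm : ∀ x y → x +ᶠ y ≈ᶠ y +ᶠ x
+ᶠ-comm (a / b [ _ ]) (c / d [ _ ]) = F./-+-comm a b c d

+ᶠ-identityˡ : ∀ x → const 0ℚ +ᶠ x ≈ᶠ x
+ᶠ-identityˡ (a / b [ _ ]) = F./-+-identityˡ (0ℚ ∷ []) a b 0∷[]≈0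

-ᶠ-inverseˡ : ∀ x → (-ᶠ x) +ᶠ x ≈ᶠ const 0ℚ
-ᶠ-inverseˡ (a / b [ _ ]) = F./-inverseˡ (0ℚ ∷ []) a b 0∷[]≈0

*ᶠ-comm : ∀ x y → x *ᶠ y ≈ᶠ y *ᶠ x
*ᶠ-comm (a / b [ _ ]) (c / d [ _ ]) = F./-*-comm a b c d

*ᶠ-identityˡ : ∀ x → const 1ℚ *ᶠ x ≈ᶠ x
*ᶠ-identityˡ (a / b [ _ ]) = F./-*-identityˡ a b

+ᶠ-cong : ∀ {x x′ y y′} → x ≈ᶠ x′ → y ≈ᶠ y′ → x +ᶠ y ≈ᶠ x′ +ᶠ y′
+ᶠ-cong {a / b [ _ ]} {a′ / b′ [ _ ]} {c / d [ _ ]} {c′ / d′ [ _ ]} =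
  F./-+-cong a b a′ b′ c d c′ d′

*ᶠ-cong : ∀ {x x′ y y′} → x ≈ᶠ x′ → y ≈ᶠ y′ → x *ᶠ y ≈ᶠ x′ *ᶠ y′
*ᶠ-cong {a / b [ _ ]} {a′ / b′ [ _ ]} {c / d [ _ ]} {c′ / d′ [ _ ]} =
  F./-*-cong a b a′ b′ c d c′ d′

*ᶠ-distribˡ : ∀ x y z → x *ᶠ (y +ᶠ z) ≈ᶠ x *ᶠ y +ᶠ x *ᶠ z
*ᶠ-distribˡ (a / b [ _ ]) (c / d [ _ ]) (e / f [ _ ]) = F./-distribˡ a b c d e f

ℚ⟨α⟩-setoid : Setoid 0ℓ 0ℓ
ℚ⟨α⟩-setoid = record
  { _≈_ = _≈ᶠ_
  ; isEquivalence = record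
    { refl  = λ _ → ≡.refl
    ; sym   = λ x≈y n → ≡.sym (x≈y n)
    ; trans = λ {x} {y} {z} → ≈ᶠ-trans {x} {y} {z}
    }
  }

ℚ⟨α⟩-commutativeRing : CommutativeRing 0ℓ 0ℓ
ℚ⟨α⟩-commutativeRing = record
  { Carrier = ℚ⟨α⟩
  ; _≈_ = _≈ᶠ_
  ; _+_ = _+ᶠ_
  ; _*_ = _*ᶠ_
  ; -_ = -ᶠ_
  ; 0# = const 0ℚ
  ; 1# = const 1ℚ
  ; isCommutativeRing = record
    { isRing = record
      { +-isAbelianGroup = record
        { isGroup = record
          { isMonoid = record
            { isSemigroup = record
              { isMagma = record
                { isEquivalence = Setoid.isEquivalence ℚ⟨α⟩-setoid
                ; ∙-cong = λ {x} {x′} {y} {y′} → +ᶠ-cong {x} {x′} {y} {y′}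
                }
              ; assoc = λ { (a / b [ _ ]) (c / d [ _ ]) (e / f [ _ ]) → F./-+-assoc a b c d e f }
              }
            ; identity = comm∧idˡ⇒id {_+ᶠ_} +ᶠ-comm {const 0ℚ} +ᶠ-identityˡ
            }
          ; inverse = comm∧invˡ⇒inv {_+ᶠ_} { -ᶠ_} {const 0ℚ} +ᶠ-comm -ᶠ-inverseˡ
          ; ⁻¹-cong = λ { {a / b [ _ ]} {a′ / b′ [ _ ]} → F./-neg-cong a b a′ b′ }
          }
        ; comm = +ᶠ-comm
        }
      ; *-cong = λ {x} {x′} {y} {y′} → *ᶠ-cong {x} {x′} {y} {y′}
      ; *-assoc = λ { (a / b [ _ ]) (c / d [ _ ]) (e / f [ _ ]) → F./-*-assoc a b c d e f }
      ; *-identity = comm∧idˡ⇒id {_*ᶠ_} *ᶠ-comm {const 1ℚ} *ᶠ-identityˡ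
      ; distrib = comm∧distrˡ⇒distr {_*ᶠ_} {_+ᶠ_} (λ {x} {x′} {y} {y′} → +ᶠ-cong {x} {x′} {y} {y′})
                    *ᶠ-comm *ᶠ-distribˡ
      }
    ; *-comm = *ᶠ-comm
    }
  }
  where
  open Consequences ℚ⟨α⟩-setoid

module K = CommutativeRing ℚ⟨α⟩-commutativeRing

open import Defs
open OperatorProperties ℚ⟨α⟩-commutativeRing
  using (IsSubring; limit; limit-isExpansion; module Uniqueness; module GouldenJackson)

-- Closure properties of ℤ[α] in ℚ(α)

embed : Poly → ℚ⟨α⟩
embed a = a / 1ℚ ∷ [] [ here (λ ()) ]

embed-cong : ∀ a b → a ≈ₚ b → embed a ≈ᶠ embed b
embed-cong a b = ℚ[α].*-congʳ {1ℚ ∷ []} {a} {b}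

embed-+ : ∀ a b → embed a +ᶠ embed b ≈ᶠ embed (a +ₚ b)
embed-+ = F./1-+-homo

embed-* : ∀ a b → embed a *ᶠ embed b ≈ᶠ embed (a *ₚ b)
embed-* = F./1-*-homo

-- Arithmetic in ℚ reduces its results, so the comparison is made among unnormalised rationals,
-- where all denominators are visibly 1.
/1-homo-+ : ∀ i j → i ℚ./ 1 ℚ.+ j ℚ./ 1 ≡ (i ℤ.+ j) ℚ./ 1
/1-homo-+ i j = ℚ.toℚᵘ-injective (begin
  ℚ.toℚᵘ (i ℚ./ 1 ℚ.+ j ℚ./ 1)              ≈⟨ ℚ.toℚᵘ-homo-+ (i ℚ./ 1) (j ℚ./ 1) ⟩
  ℚ.toℚᵘ (i ℚ./ 1) ℚᵘ.+ ℚ.toℚᵘ (j ℚ./ 1)    ≈⟨ ℚᵘ.+-cong (ℚ.toℚᵘ-fromℚᵘ (i ℚᵘ./ 1)) (ℚ.toℚᵘ-fromℚᵘ (j ℚᵘ./ 1)) ⟩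
  i ℚᵘ./ 1 ℚᵘ.+ j ℚᵘ./ 1                    ≡⟨ cong (ℚᵘ._/ 1) (cong₂ ℤ._+_ (ℤ.*-identityʳ i) (ℤ.*-identityʳ j)) ⟩
  (i ℤ.+ j) ℚᵘ./ 1                          ≈⟨ ℚ.toℚᵘ-fromℚᵘ ((i ℤ.+ j) ℚᵘ./ 1) ⟨
  ℚ.toℚᵘ ((i ℤ.+ j) ℚ./ 1)                  ∎)
  where open SetoidReasoning ℚᵘ.≃-setoid

/1-homo-* : ∀ i j → (i ℚ./ 1) ℚ.* (j ℚ./ 1) ≡ (i ℤ.* j) ℚ./ 1
/1-homo-* i j = ℚ.toℚᵘ-injective (begin
  ℚ.toℚᵘ ((i ℚ./ 1) ℚ.* (j ℚ./ 1))          ≈⟨ ℚ.toℚᵘ-homo-* (i ℚ./ 1) (j ℚ./ 1) ⟩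
  ℚ.toℚᵘ (i ℚ./ 1) ℚᵘ.* ℚ.toℚᵘ (j ℚ./ 1)    ≈⟨ ℚᵘ.*-cong (ℚ.toℚᵘ-fromℚᵘ (i ℚᵘ./ 1)) (ℚ.toℚᵘ-fromℚᵘ (j ℚᵘ./ 1)) ⟩
  (i ℤ.* j) ℚᵘ./ 1                          ≈⟨ ℚ.toℚᵘ-fromℚᵘ ((i ℤ.* j) ℚᵘ./ 1) ⟨
  ℚ.toℚᵘ ((i ℤ.* j) ℚ./ 1)                  ∎)
  where open SetoidReasoning ℚᵘ.≃-setoid

-- Integrality is tracked coefficient by coefficient inside ℚ[α], so sums and products remain those
-- of `Poly`; the integer polynomial is read off at the end by `All⇒map-/1`.
IsInteger : ℚ → Set
IsInteger x = ∃ λ i → x ≡ i ℚ./ 1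

IsInteger-+ : ∀ {x y} → IsInteger x → IsInteger y → IsInteger (x ℚ.+ y)
IsInteger-+ (i , ≡.refl) (j , ≡.refl) = i ℤ.+ j , /1-homo-+ i j

IsInteger-* : ∀ {x y} → IsInteger x → IsInteger y → IsInteger (x ℚ.* y)
IsInteger-* (i , ≡.refl) (j , ≡.refl) = i ℤ.* j , /1-homo-* i j

All-+ₚ : ∀ {a b} → All IsInteger a → All IsInteger b → All IsInteger (a +ₚ b)
All-+ₚ []       ys       = ys
All-+ₚ (x ∷ xs) []       = x ∷ xs
All-+ₚ (x ∷ xs) (y ∷ ys) = IsInteger-+ x y ∷ All-+ₚ xs ys

All-scale : ∀ {x b} → IsInteger x → All IsInteger b → All IsInteger (scale x b)
All-scale x []       = []
All-scale x (y ∷ ys) = IsInteger-* x y ∷ All-scale x ys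

All-*ₚ : ∀ {a b} → All IsInteger a → All IsInteger b → All IsInteger (a *ₚ b)
All-*ₚ []       ys = []
All-*ₚ (x ∷ xs) ys = All-+ₚ (All-scale x ys) ((+ 0 , ≡.refl) ∷ All-*ₚ xs ys)

All-map-/1 : ∀ q → All IsInteger (map (ℚ._/ 1) q)
All-map-/1 []      = []
All-map-/1 (i ∷ q) = (i , ≡.refl) ∷ All-map-/1 q

All⇒map-/1 : ∀ {a} → All IsInteger a → ∃ λ q → a ≡ map (ℚ._/ 1) q
All⇒map-/1 []                 = [] , ≡.refl
All⇒map-/1 ((i , ≡.refl) ∷ xs) with All⇒map-/1 xs
... | q , ≡.refl = i ∷ q , ≡.refl

∈ℤ[α]-resp : ∀ {x y} → x ≈ᶠ y → y ∈ℤ[α] → x ∈ℤ[α]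
∈ℤ[α]-resp {x} {y} x≈y (q , y≈q) = q , ≈ᶠ-trans {x} {y} {embed (map (ℚ._/ 1) q)} x≈y y≈q

embed-∈ : ∀ {a} → All IsInteger a → embed a ∈ℤ[α]
embed-∈ as with All⇒map-/1 as
... | q , ≡.refl = q , λ _ → ≡.refl

∈ℤ[α]-+ : ∀ {x y} → x ∈ℤ[α] → y ∈ℤ[α] → (x +ᶠ y) ∈ℤ[α]
∈ℤ[α]-+ {x} {y} (q , x≈q) (r , y≈r) =
  ∈ℤ[α]-resp {x +ᶠ y} {embed (a +ₚ b)}
    (≈ᶠ-trans {x +ᶠ y} {embed a +ᶠ embed b} {embed (a +ₚ b)}
      (+ᶠ-cong {x} {embed a} {y} {embed b} x≈q y≈r) (embed-+ a b))
    (embed-∈ (All-+ₚ (All-map-/1 q) (All-map-/1 r)))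
  where
  a = map (ℚ._/ 1) q
  b = map (ℚ._/ 1) r

∈ℤ[α]-* : ∀ {x y} → x ∈ℤ[α] → y ∈ℤ[α] → (x *ᶠ y) ∈ℤ[α]
∈ℤ[α]-* {x} {y} (q , x≈q) (r , y≈r) =
  ∈ℤ[α]-resp {x *ᶠ y} {embed (a *ₚ b)}
    (≈ᶠ-trans {x *ᶠ y} {embed a *ᶠ embed b} {embed (a *ₚ b)}
      (*ᶠ-cong {x} {embed a} {y} {embed b} x≈q y≈r) (embed-* a b))
    (embed-∈ (All-*ₚ (All-map-/1 q) (All-map-/1 r)))
  where
  a = map (ℚ._/ 1) q
  b = map (ℚ._/ 1) r

α∈ℤ[α] : α ∈ℤ[α]
α∈ℤ[α] = + 0 ∷ + 1 ∷ [] , λ _ → ≡.refl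

∈ℤ[α]-isSubring : IsSubring _∈ℤ[α]
∈ℤ[α]-isSubring = record
  { Z-resp = λ {x} {y} → ∈ℤ[α]-resp {x} {y}
  ; Z-0    = + 0 ∷ [] , λ _ → ≡.refl
  ; Z-1    = + 1 ∷ [] , λ _ → ≡.refl
  ; Z-−1   = ℤ.-1ℤ ∷ [] , λ _ → ≡.refl
  ; Z-+    = λ {x} {y} → ∈ℤ[α]-+ {x} {y}
  ; Z-*    = λ {x} {y} → ∈ℤ[α]-* {x} {y}
  }

-- Positive integers are invertible in ℚ(α)

infixr 8 _×1
_×1 : ℕ → ℚ
zero  ×1 = 0ℚ
suc n ×1 = 1ℚ ℚ.+ n ×1

-- Characteristic zero is obtained from the order of ℚ. A lower bound passes from n to n + 1, which
-- mere nonvanishing would not.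
1≤suc-×1 : ∀ n → 1ℚ ℚ.≤ suc n ×1
1≤suc-×1 n = ℚ.≤-trans (ℚ.≤-reflexive (≡.sym (ℚ.+-identityʳ 1ℚ))) (ℚ.+-monoʳ-≤ 1ℚ (×1-nonNeg n))
  where
  ×1-nonNeg : ∀ n → 0ℚ ℚ.≤ n ×1
  ×1-nonNeg zero    = ℚ.≤-refl
  ×1-nonNeg (suc n) = ℚ.≤-trans (ℚ.nonNegative⁻¹ 1ℚ) (1≤suc-×1 n)

suc-×1-≢0 : ∀ n → suc n ×1 ≢ 0ℚ
suc-×1-≢0 n eq = ℚ.<⇒≢ (ℚ.<-≤-trans (ℚ.positive⁻¹ 1ℚ) (1≤suc-×1 n)) (≡.sym eq)

ι-const : ∀ n → ι n ≈ᶠ embed (n ×1 ∷ [])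
ι-const zero    = λ _ → ≡.refl
ι-const (suc n) = ≈ᶠ-trans {ι (suc n)} {embed (1ℚ ∷ []) +ᶠ embed (n ×1 ∷ [])} {embed (suc n ×1 ∷ [])}
  (+ᶠ-cong {const 1ℚ} {embed (1ℚ ∷ [])} {ι n} {embed (n ×1 ∷ [])} (λ _ → ≡.refl) (ι-const n))
  (embed-+ (1ℚ ∷ []) (n ×1 ∷ []))

embed-inverse : ∀ q → q ≢ 0ℚ → ∃ λ y → y *ᶠ embed (q ∷ []) ≈ᶠ const 1ℚ
embed-inverse q q≢0 =
  embed (r ∷ []) , embed-cong (r ℚ.* q ℚ.+ 0ℚ ∷ []) (1ℚ ∷ [])
    (∷-cong {a = []} {b = []} (≡.trans (ℚ.+-identityʳ (r ℚ.* q)) (ℚ.*-inverseˡ q)) (λ _ → ≡.refl))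
  where
  instance _ = ℚ.≢-nonZero q≢0
  r = ℚ.1/ q

ι-inverse : ∀ n → ∃ λ y → y *ᶠ ι (suc n) ≈ᶠ const 1ℚ
ι-inverse n with embed-inverse (suc n ×1) (suc-×1-≢0 n)
... | y , yq≈1 = y ,
  ≈ᶠ-trans {y *ᶠ ι (suc n)} {y *ᶠ embed (suc n ×1 ∷ [])} {const 1ℚ}
    (K.*-congˡ {y} {ι (suc n)} {embed (suc n ×1 ∷ [])} (ι-const (suc n))) yq≈1

-- Integrality of all expansions

open Uniqueness ι-inverse using (expansion-unique)
open GouldenJackson α (const (+ 3 ℚ./ 2))

³⁄₂+³⁄₂∈ℤ[α] : (const (+ 3 ℚ./ 2) +ᶠ const (+ 3 ℚ./ 2)) ∈ℤ[α]
³⁄₂+³⁄₂∈ℤ[α] = + 3 ∷ [] , λ _ → ≡.refl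

-- Uniqueness transfers integrality from the one computed expansion to every other. The existence
-- component keeps the claim about all expansions from being vacuous.
integral-expansion : ∀ {Δ} c₀ → IsExpansion Δ c₀ → (∀ b → c₀ b ∈ℤ[α]) →
  (∃ λ c → IsExpansion Δ c) × (∀ c → IsExpansion Δ c → ∀ I J → c (I , J) ∈ℤ[α])
integral-expansion c₀ exp₀ int = (c₀ , exp₀) , λ c exp I J →
  ∈ℤ[α]-resp {c (I , J)} {c₀ (I , J)}
    (expansion-unique exp exp₀ _ I J (ℕ.n<1+n (length J))) (int (I , J))

proposition9p1 : ((∃ λ c → IsExpansion Δ₂ c) × (∀ c → IsExpansion Δ₂ c → ∀ I J → c (I , J) ∈ℤ[α])) ×
    ((∃ λ c → IsExpansion Δ₃ c) × (∀ c → IsExpansion Δ₃ c → ∀ I J → c (I , J) ∈ℤ[α]))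
proposition9p1 =
  integral-expansion (limit e₂) (limit-isExpansion e₂ e₂-locallyFinite)
    (Z-limit-e₂ ∈ℤ[α]-isSubring α∈ℤ[α] ³⁄₂+³⁄₂∈ℤ[α]) ,
  integral-expansion (limit e₃) (limit-isExpansion e₃ e₃-locallyFinite)
    (Z-limit-e₃ ∈ℤ[α]-isSubring α∈ℤ[α] ³⁄₂+³⁄₂∈ℤ[α])
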